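{- Let $k,t$ be integers with $\left\lceil\frac{t+2}{2}\right\rceil\leq k\leq t-1$ and $k\geq 5$, and let $H$ be the graph obtained from the complete graph $K_t$ by deleting the edges of a maximal matching $M$ of $K_t$. Then $$\operatorname{gr}_k(P_5:H)=\max\left\{\left\lceil\frac{1+\sqrt{1+8k}}{2}\right\rceil,\;t+1\right\}.$$
   Context: All graphs are finite, simple and undirected. $K_n$ is the complete graph on $n$ vertices and $P_5$ is the path with $5$ vertices and $4$ edges. A $k$-edge-coloring assigns to each edge one of $k$ colors; all $k$-edge-colorings are assumed exact, i.e. each of the $k$ colors is used at least once. An edge-colored graph is rainbow if all its edges have different colors and monochromatic if all its edges have a single color. A copy of a graph means a (not necessarily induced) subgraph isomorphic to it. For non-empty graphs $G,H$ (graphs with at least one edge) and a positive integer $k$, the Gallai-Ramsey number $\operatorname{gr}_k(G:H)$ is the minimum integer $N$ with $\binom{N}{2}\geq k$ (so that $K_N$ admits a $k$-edge-coloring) such that for all $n\geq N$, every $k$-edge-coloring of $K_n$ contains either a rainbow copy of $G$ or a monochromatic copy of $H$. -}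

module Defs where

open import Level using (0ℓ)
open import Data.Nat
open import Data.Nat.Properties using (_≟_; _≤?_; ≤-trans; m≤m+n; m≤m*n; 1+n≢n; +-suc)
open import Data.Nat.Combinatorics using (_C_)
open import Data.Fin using (Fin; toℕ)
import Data.Fin.Properties as Fin
open import Data.Product using (Σ; ∃; ∃-syntax; _×_; _,_; proj₁; proj₂)
open import Data.Sum using (_⊎_; inj₁; inj₂; swap)
open import Function using (_∘_; Injective)
open import Relation.Binary using (Rel; Decidable; Symmetric)
import Relation.Unary as U
open import Relation.Nullary using (¬_; yes; no; contradiction)
open import Relation.Nullary.Decidable using (¬?; _×-dec_; _⊎-dec_)
open import Relation.Binary.PropositionalEquality using (_≡_; _≢_; refl; sym)

IsLeast : (ℕ → Set) → ℕ → Set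
IsLeast P m = P m × (∀ n → P n → m ≤ n)

least : ∀ {P : ℕ → Set} → U.Decidable P → ∀ b → P b → ∃ (IsLeast P)
least P? b pb with P? 0
... | yes p0 = 0 , p0 , λ _ _ → z≤n
least P? zero    pb | no ¬p0 = contradiction pb ¬p0
least P? (suc b) pb | no ¬p0 with least (P? ∘ suc) b pb
... | m , pm , min = suc m , pm , λ where
        zero    p0 → contradiction p0 ¬p0
        (suc n) pn → s≤s (min n pn)

-- The real inequality (1 + √x) / 2 ≤ m, i.e. √x ≤ 2m - 1, holds exactly when
-- 2m - 1 is nonnegative and its square is at least x.
[1+√_]/2≤_ : ℕ → ℕ → Set
[1+√ x ]/2≤ m = 1 ≤ 2 * m × x ≤ (2 * m ∸ 1) ^ 2

[1+√_]/2≤?_ : ∀ x → U.Decidable ([1+√ x ]/2≤_)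
[1+√ x ]/2≤? m = 1 ≤? 2 * m ×-dec x ≤? (2 * m ∸ 1) ^ 2

[1+√]/2-bounded : ∀ x → [1+√ x ]/2≤ suc x
[1+√]/2-bounded x = s≤s z≤n , ≤-trans (m≤m+n x _) lemma
  where
  lemma : x + (suc x + 0) ≤ (x + (suc x + 0)) ^ 2
  lemma rewrite +-suc x (x + 0) = m≤m*n (suc (x + (x + 0))) (suc (x + (x + 0)) * 1)

-- The ceiling of (1 + √x) / 2.  That real number is positive, so the least integer
-- above it is the least natural number above it.
⌈[1+√_]/2⌉ : ℕ → ℕ
⌈[1+√ x ]/2⌉ = proj₁ (least ([1+√ x ]/2≤?_) (suc x) ([1+√]/2-bounded x))

record Graph : Set₁ where
  field
    order  : ℕ
    Adj    : Rel (Fin order) 0ℓ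
    adj?   : Decidable Adj
    symm   : Symmetric Adj
    irrefl : ∀ {u} → ¬ Adj u u

  Vertex : Set
  Vertex = Fin order

open Graph public using (order; Vertex)

K : ℕ → Graph
K n = record
  { order  = n
  ; Adj    = _≢_
  ; adj?   = λ u v → ¬? (u Fin.≟ v)
  ; symm   = λ u≢v → u≢v ∘ sym
  ; irrefl = λ u≢u → u≢u refl
  }

P₅ : Graph
P₅ = record
  { order  = 5
  ; Adj    = λ u v → suc (toℕ u) ≡ toℕ v ⊎ suc (toℕ v) ≡ toℕ u
  ; adj?   = λ u v → (suc (toℕ u) ≟ toℕ v) ⊎-dec (suc (toℕ v) ≟ toℕ u)
  ; symm   = swap
  ; irrefl = λ { (inj₁ e) → 1+n≢n e ; (inj₂ e) → 1+n≢n e }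
  }

-- A set of (unordered) edges, given as a symmetric relation on the vertices.
record EdgeSet (G : Graph) : Set₁ where
  field
    Mem   : Rel (Vertex G) 0ℓ
    mem?  : Decidable Mem
    symm  : Symmetric Mem
    edges : ∀ {u v} → Mem u v → Graph.Adj G u v

_⊆_ : ∀ {G} → EdgeSet G → EdgeSet G → Set
M ⊆ M′ = ∀ {u v} → EdgeSet.Mem M u v → EdgeSet.Mem M′ u v

IsMatching : ∀ {G} → EdgeSet G → Set
IsMatching M = ∀ {u v w} → EdgeSet.Mem M u v → EdgeSet.Mem M u w → v ≡ w

IsMaximalMatching : ∀ {G} → EdgeSet G → Set₁
IsMaximalMatching {G} M =
  IsMatching M × (∀ (M′ : EdgeSet G) → IsMatching M′ → M ⊆ M′ → M′ ⊆ M)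

_-ᴱ_ : (G : Graph) → EdgeSet G → Graph
G -ᴱ M = record
  { order  = order G
  ; Adj    = λ u v → Graph.Adj G u v × ¬ EdgeSet.Mem M u v
  ; adj?   = λ u v → Graph.adj? G u v ×-dec ¬? (EdgeSet.mem? M u v)
  ; symm   = λ (a , ¬m) → Graph.symm G a , ¬m ∘ EdgeSet.symm M
  ; irrefl = λ (a , _) → Graph.irrefl G a
  }

-- Colours are also assigned to non-adjacent pairs, but those values are never
-- inspected: every notion below looks only at the colours of edges.
record EdgeColoring (k : ℕ) (G : Graph) : Set where
  field
    color : Vertex G → Vertex G → Fin k
    symm  : ∀ u v → color u v ≡ color v u
    exact : ∀ c → ∃[ u ] ∃[ v ] Graph.Adj G u v × color u v ≡ c

-- A copy of G in F, presented by an isomorphism from G onto a subgraph of F.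
record Copy (G F : Graph) : Set where
  field
    map       : Vertex G → Vertex F
    injective : Injective _≡_ _≡_ map
    edges     : ∀ {u v} → Graph.Adj G u v → Graph.Adj F (map u) (map v)

module _ {k : ℕ} {G F : Graph} (χ : EdgeColoring k F) (φ : Copy G F) where
  private
    colorOf : Vertex G → Vertex G → Fin k
    colorOf u v = EdgeColoring.color χ (Copy.map φ u) (Copy.map φ v)

  IsRainbow : Set
  IsRainbow = ∀ {u v x y} → Graph.Adj G u v → Graph.Adj G x y →
    colorOf u v ≡ colorOf x y → (u ≡ x × v ≡ y) ⊎ (u ≡ y × v ≡ x)

  IsMonochromatic : Set
  IsMonochromatic = ∃[ c ] (∀ {u v} → Graph.Adj G u v → colorOf u v ≡ c)

GallaiRamseyBound : ℕ → Graph → Graph → ℕ → Set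
GallaiRamseyBound k G H N = k ≤ N C 2 ×
  (∀ n → N ≤ n → (χ : EdgeColoring k (K n)) →
    (Σ (Copy G (K n)) (IsRainbow χ)) ⊎ (Σ (Copy H (K n)) (IsMonochromatic χ)))

-- gr k (G : H) = N, as a relation, since the existence of the minimum is itself a theorem.
gr_[_∶_]≡_ : ℕ → Graph → Graph → ℕ → Set
gr k [ G ∶ H ]≡ N = IsLeast (GallaiRamseyBound k G H) N

{-# OPTIONS --safe #-}

-- Let n ≥ t + 1 and suppose that a colouring of K_n with k ≥ 5 colours has no rainbow P₅.
-- Let a vertex a see at least three colours.  If two colours were missing at a, the edges
-- carrying them would lie on a rainbow P₅.  If one colour is missing at a, it spreads from an
-- edge to all adjacent ones in K_n - a; if none is, any two adjacent edges of K_n - a agree.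
-- So K_n - a is monochromatic and contains H because n - 1 ≥ t.  Otherwise every vertex sees
-- at most two colours, any two of these colour pairs meet, and having more than three
-- colours they share a colour D.  The remaining k - 1 colours then live on disjoint vertex
-- sets joined by D, so D contains the complete multipartite graph with k - 1 parts of size 2,
-- hence H, since t ≤ 2(k - 1).
-- Conversely k ≤ C(N,2) gives the bound with the square root, and colouring K_t so that
-- the edges at one vertex carry all colours while all other edges share one of them
-- yields neither a rainbow P₅ nor a monochromatic H.
module Submission where

open import Data.Bool using (Bool; true; false)
open import Data.Empty using (⊥; ⊥-elim)
open import Data.Fin as Fin using (Fin; zero; suc; toℕ; fromℕ<; inject≤; inject₁; punchIn; join; splitAt)
open import Data.Fin.Patterns using (0F; 1F; 2F; 3F; 4F; 5F; 6F)
open import Data.Fin.Properties using (_≟_; any?; all?; injective⇒≤)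
import Data.Fin.Properties as Fin
open import Data.List using (List; []; _∷_; filter)
import Data.List.Membership.DecPropositional as DecMembership
import Data.List.Membership.Propositional as List
open import Data.List.Membership.Propositional.Properties using (∈-filter⁺)
import Data.List.Relation.Unary.Any as List
open import Data.Nat as ℕ using (ℕ; suc; _+_; _*_; _∸_; _^_; _≤_; _<_; _⊔_; ⌈_/2⌉; ⌊_/2⌋; z≤n; s≤s)
open import Data.Nat.Combinatorics using (_C_; nC1≡n; nCk+nC[k+1]≡[n+1]C[k+1])
import Data.Nat.Properties as ℕ
open import Data.Nat.Tactic.RingSolver using (solve-∀)
open import Data.Product using (Σ; ∃-syntax; _×_; _,_; proj₁; proj₂)
open import Data.Sum using (_⊎_; inj₁; inj₂; [_,_]′; swap)
open import Data.Vec as Vec using (Vec; []; _∷_; lookup)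
import Data.Vec.Relation.Unary.All as All
open All using (All; []; _∷_)
import Data.Vec.Relation.Unary.AllPairs as AllPairs
open AllPairs using ([]; _∷_)
import Data.Vec.Relation.Unary.Any as Any
open import Data.Vec.Relation.Unary.Any.Properties using (lookup-index)
open import Data.Vec.Relation.Unary.Unique.Propositional using (Unique)
open import Data.Vec.Relation.Unary.Unique.Propositional.Properties using (map⁺; lookup-injective)
open import Defs
open import Function using (_∘_; Injective)
open import Relation.Binary.PropositionalEquality using (_≡_; _≢_; refl; sym; trans; cong; cong₂; subst; ≢-sym; module ≡-Reasoning)
open import Relation.Nullary using (¬_; Dec; yes; no; contradiction)
open import Relation.Nullary.Decidable using (True; map′; toWitness; ¬?; _×-dec_; _⊎-dec_; _→-dec_; decidable-stable)
open import Relation.Unary using (Decidable)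

-- Distinctness in finite sequences and fresh elements.

unique? : ∀ {n m} → Decidable (Unique {A = Fin n} {m})
unique? = AllPairs.allPairs? (λ i j → ¬? (i ≟ j))

-- Paths are selected from one duplicate-free vector by literal indices, whose distinctness is
-- settled by evaluating the implicit `True` argument.
pick : ∀ {A : Set} {m l} {xs : Vec A m} → Unique xs →
  (is : Vec (Fin m) l) {_ : True (unique? is)} → Unique (Vec.map (lookup xs) is)
pick xs! is {is!} = map⁺ (lookup-injective xs! _ _) (toWitness is!)

distinct : ∀ {A : Set} {m} {xs : Vec A m} → Unique xs →
  ∀ i j {_ : True (¬? (i ≟ j))} → lookup xs i ≢ lookup xs j
distinct xs! i j {i≢j} = toWitness i≢j ∘ lookup-injective xs! i j

-- Pigeonhole: if every element of `Fin n` occurred in `xs`, the position of an occurrence would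
-- inject `Fin n` into `Fin m`.
avoid : ∀ {n m} → m < n → (xs : Vec (Fin n) m) → ∃[ v ] All (v ≢_) xs
avoid {n} m<n xs with any? (λ v → All.all? (λ x → ¬? (v ≟ x)) xs)
... | yes fresh = fresh
... | no ¬fresh = contradiction (injective⇒≤ index-injective) (ℕ.<⇒≱ m<n)
  where
  occurs : ∀ v → Any.Any (v ≡_) xs
  occurs v with Any.any? (v ≟_) xs
  ... | yes v∈xs = v∈xs
  ... | no v∉xs = contradiction (v , go xs v∉xs) ¬fresh
    where
    go : ∀ {m} (ys : Vec (Fin n) m) → ¬ Any.Any (v ≡_) ys → All (v ≢_) ys
    go [] _ = []
    go (y ∷ ys) v∉ = v∉ ∘ Any.here ∷ go ys (v∉ ∘ Any.there)

  index-injective : ∀ {u v} → Any.index (occurs u) ≡ Any.index (occurs v) → u ≡ v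
  index-injective {u} {v} eq = trans (lookup-index (occurs u))
    (trans (cong (lookup xs) eq) (sym (lookup-index (occurs v))))

-- Colourings without a rainbow path on five vertices.

pathColors : ∀ {A B : Set} {m} → (A → A → B) → Vec A (suc m) → Vec B m
pathColors color (v ∷ [])     = []
pathColors color (u ∷ v ∷ vs) = color u v ∷ pathColors color (v ∷ vs)

-- `c` and `d` may coincide and need not occur, so this means at most two colours at `a`.
2ColoredAt : ∀ {n k} → (Fin n → Fin n → Fin k) → Fin n → Set
2ColoredAt color a = ∃[ c ] ∃[ d ] ∀ v → v ≢ a → color a v ≡ c ⊎ color a v ≡ d

module NoRainbowPath {n k : ℕ} (color : Fin n → Fin n → Fin k)
  (color-sym : ∀ u v → color u v ≡ color v u)
  (noRainbow : ∀ {vs : Vec (Fin n) 5} → Unique vs → ¬ Unique (pathColors color vs)) where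

  notAllDistinct : ∀ {u v w x y a b c d} → Unique (u ∷ v ∷ w ∷ x ∷ y ∷ []) →
    color u v ≡ a → color v w ≡ b → color w x ≡ c → color x y ≡ d → ¬ Unique (a ∷ b ∷ c ∷ d ∷ [])
  notAllDistinct vs! refl refl refl refl = noRainbow vs!

  -- Vertices and colours are named by their indices in duplicate-free vectors, so that the
  -- distinctness required along a path is decided by computation.
  module Configuration {m l} {vs : Vec (Fin n) m} (vs! : Unique vs)
    {cs : Vec (Fin k) l} (cs! : Unique cs) where

    open DecMembership (_≟_ {l}) using (_∈?_)

    infix 4 _—_∶_ _—_∶∈_ _—_∶∈?_

    -- A record instead of the bare equation, so that the indices can be inferred from the type;
    -- `lookup` would hide them.
    record _—_∶_ (u v : Fin m) (c : Fin l) : Set where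
      constructor ⟨_⟩
      field color≡ : color (lookup vs u) (lookup vs v) ≡ lookup cs c

    _—_∶∈_ : Fin m → Fin m → List (Fin l) → Set
    u — v ∶∈ cs = List.Any (u — v ∶_) cs

    reverse : ∀ {u v c} → u — v ∶ c → v — u ∶ c
    reverse ⟨ uv≡c ⟩ = ⟨ trans (color-sym _ _) uv≡c ⟩

    reverse∈ : ∀ {u v cs} → u — v ∶∈ cs → v — u ∶∈ cs
    reverse∈ = List.map reverse

    -- Intersects two lists of candidates for the colour of one edge. On literal indices the
    -- `filter` evaluates, so several path arguments combine into one explicit short list.
    meet : ∀ {u v as bs} → u — v ∶∈ as → u — v ∶∈ bs → u — v ∶∈ filter (_∈? bs) as
    meet ∈as ∈bs with List.find ∈as | List.find ∈bs
    ... | a , a∈as , ⟨ uv≡a ⟩ | b , b∈bs , ⟨ uv≡b ⟩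
      with refl ← lookup-injective cs! a b (trans (sym uv≡a) uv≡b)
      = List.lose (∈-filter⁺ (_∈? _) a∈as b∈bs) ⟨ uv≡a ⟩

    only : ∀ {u v c} → u — v ∶∈ c ∷ [] → u — v ∶ c
    only (List.here uv∶c) = uv∶c

    clash : ∀ {u v cs} c {_ : True (¬? (c ∈? cs))} → u — v ∶∈ cs → ¬ u — v ∶ c
    clash c {c∉} uv∈ ⟨ uv≡c ⟩ with d , d∈ , ⟨ uv≡d ⟩ ← List.find uv∈
      with refl ← lookup-injective cs! c d (trans (sym uv≡c) uv≡d) = toWitness c∉ d∈

    _—_∶∈?_ : ∀ u v cs → Dec (u — v ∶∈ cs)
    u — v ∶∈? cs′ = List.any? (λ c → map′ ⟨_⟩ _—_∶_.color≡ (color (lookup vs u) (lookup vs v) ≟ lookup cs c)) cs′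

    -- Any colour beyond the three on the first edges would complete a rainbow path. Vertices and
    -- known colours are given in path order.
    fourthColor : ∀ u v w x y a b c →
      {_ : True (unique? (u ∷ v ∷ w ∷ x ∷ y ∷ []))} {_ : True (unique? (a ∷ b ∷ c ∷ []))} →
      u — v ∶ a → v — w ∶ b → w — x ∶ c → x — y ∶∈ a ∷ b ∷ c ∷ []
    fourthColor u v w x y a b c {path} {palette} ⟨ uv ⟩ ⟨ vw ⟩ ⟨ wx ⟩ with x — y ∶∈? (a ∷ b ∷ c ∷ [])
    ... | yes xy = xy
    ... | no ¬xy with pick cs! (a ∷ b ∷ c ∷ []) {palette}
    ...   | (a≢b ∷ a≢c ∷ []) ∷ (b≢c ∷ []) ∷ [] ∷ [] =
      contradiction
        ( (a≢b ∷ a≢c ∷ ¬xy ∘ List.here ∘ ⟨_⟩ ∘ sym ∷ [])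
        ∷ (b≢c ∷ ¬xy ∘ List.there ∘ List.here ∘ ⟨_⟩ ∘ sym ∷ [])
        ∷ (¬xy ∘ List.there ∘ List.there ∘ List.here ∘ ⟨_⟩ ∘ sym ∷ [])
        ∷ [] ∷ [])
        (notAllDistinct (pick vs! (u ∷ v ∷ w ∷ x ∷ y ∷ []) {path}) uv vw wx refl)

    -- The same argument with the unknown colour on the second edge.
    secondColor : ∀ u v w x y a b c →
      {_ : True (unique? (u ∷ v ∷ w ∷ x ∷ y ∷ []))} {_ : True (unique? (a ∷ b ∷ c ∷ []))} →
      u — v ∶ a → w — x ∶ b → x — y ∶ c → v — w ∶∈ a ∷ b ∷ c ∷ []
    secondColor u v w x y a b c {path} {palette} ⟨ uv ⟩ ⟨ wx ⟩ ⟨ xy ⟩ with v — w ∶∈? (a ∷ b ∷ c ∷ [])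
    ... | yes vw = vw
    ... | no ¬vw with pick cs! (a ∷ b ∷ c ∷ []) {palette}
    ...   | (a≢b ∷ a≢c ∷ []) ∷ (b≢c ∷ []) ∷ [] ∷ [] =
      contradiction
        ( (¬vw ∘ List.here ∘ ⟨_⟩ ∘ sym ∷ a≢b ∷ a≢c ∷ [])
        ∷ (¬vw ∘ List.there ∘ List.here ∘ ⟨_⟩ ∷ ¬vw ∘ List.there ∘ List.there ∘ List.here ∘ ⟨_⟩ ∷ [])
        ∷ (b≢c ∷ [])
        ∷ [] ∷ [])
        (notAllDistinct (pick vs! (u ∷ v ∷ w ∷ x ∷ y ∷ []) {path}) uv refl wx xy)

  -- This says that `a` sees more than `m` colours, in the form in which it is applied: excluding
  -- any `m` colours still leaves an edge at `a`.
  Rich : Fin n → ℕ → Set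
  Rich a m = (cs : Vec (Fin k) m) → ∃[ v ] v ≢ a × All (color a v ≢_) cs

  Missing : Fin n → Fin k → Set
  Missing a c = ∀ v → v ≢ a → color a v ≢ c

  ≢-endpoint : ∀ {a u v} → color a u ≢ color a v → u ≢ v
  ≢-endpoint au≢av refl = au≢av refl

  missing-avoids : ∀ {a c x y} → Missing a c → x ≢ y → color x y ≡ c → x ≢ a × y ≢ a
  missing-avoids ¬c x≢y xy≡c =
      (λ { refl → ¬c _ (≢-sym x≢y) xy≡c })
    , (λ { refl → ¬c _ x≢y (trans (color-sym _ _) xy≡c) })

  -- A vertex that misses two colours.

  module TwoMissingColors {a} (rich : Rich a 2) {c d} (c≢d : c ≢ d)
    (¬c : Missing a c) (¬d : Missing a d) where

    -- Otherwise the path `y`, `x`, `z`, `a`, `v` is rainbow, since `c` and `d` do not occur at `a`.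
    -- The two colours are bound afresh so that they can be interchanged.
    around : ∀ {x y z v c d} → c ≢ d → Missing a c → Missing a d →
      Unique (a ∷ x ∷ y ∷ z ∷ v ∷ []) → color x y ≡ c → color x z ≡ d → color a v ≡ color a z
    around {x} {y} {z} {v} {c} {d} c≢d ¬c ¬d vs! xy≡c xz≡d with color a v ≟ color a z
    ... | yes av≡az = av≡az
    ... | no av≢az = ⊥-elim (clash 3F
      (fourthColor 2F 1F 3F 0F 4F 0F 1F 2F (reverse ⟨ xy≡c ⟩) ⟨ xz≡d ⟩ (reverse ⟨ refl ⟩)) ⟨ refl ⟩)
      where
      z≢a = distinct vs! 3F 0F
      v≢a = distinct vs! 4F 0F
      open Configuration vs! {c ∷ d ∷ color a z ∷ color a v ∷ []}
        ( (c≢d ∷ ≢-sym (¬c z z≢a) ∷ ≢-sym (¬c v v≢a) ∷ [])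
        ∷ (≢-sym (¬d z z≢a) ∷ ≢-sym (¬d v v≢a) ∷ []) ∷ (≢-sym av≢az ∷ []) ∷ [] ∷ [])

    -- Using `around` with both orders of the colours, every edge at `a` other than the one to `x`
    -- has the colour of the edge to `p`. Then `a` sees at most two colours.
    adjacent : 4 < n → ∀ {x y z} → x ≢ a → y ≢ a → z ≢ a → x ≢ y → x ≢ z → y ≢ z →
      color x y ≡ c → color x z ≢ d
    adjacent 4<n {x} {y} {z} x≢a y≢a z≢a x≢y x≢z y≢z xy≡c xz≡d
      with p , p≢a ∷ p≢x ∷ p≢y ∷ p≢z ∷ [] ← avoid 4<n (a ∷ x ∷ y ∷ z ∷ [])
      with v , v≢a , av≢ax ∷ av≢ap ∷ [] ← rich (color a x ∷ color a p ∷ []) =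
      av≢ap (constant v≢a (≢-endpoint av≢ax))
      where
      vs! : ∀ {v} → v ≢ a → v ≢ x → v ≢ y → v ≢ z → Unique (a ∷ x ∷ y ∷ z ∷ v ∷ [])
      vs! v≢a v≢x v≢y v≢z =
          (≢-sym x≢a ∷ ≢-sym y≢a ∷ ≢-sym z≢a ∷ ≢-sym v≢a ∷ [])
        ∷ (x≢y ∷ x≢z ∷ ≢-sym v≢x ∷ []) ∷ (y≢z ∷ ≢-sym v≢y ∷ []) ∷ (≢-sym v≢z ∷ []) ∷ [] ∷ []

      viaZ : ∀ {v} → v ≢ a → v ≢ x → v ≢ y → v ≢ z → color a v ≡ color a z
      viaZ v≢a v≢x v≢y v≢z = around c≢d ¬c ¬d (vs! v≢a v≢x v≢y v≢z) xy≡c xz≡d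

      viaY : ∀ {v} → v ≢ a → v ≢ x → v ≢ y → v ≢ z → color a v ≡ color a y
      viaY v≢a v≢x v≢y v≢z = around (≢-sym c≢d) ¬d ¬c
        (pick (vs! v≢a v≢x v≢y v≢z) (0F ∷ 1F ∷ 3F ∷ 2F ∷ 4F ∷ [])) xz≡d xy≡c

      constant : ∀ {v} → v ≢ a → v ≢ x → color a v ≡ color a p
      constant {v} v≢a v≢x with v ≟ y | v ≟ z
      ... | yes refl | _        = sym (viaY p≢a p≢x p≢y p≢z)
      ... | no _     | yes refl = sym (viaZ p≢a p≢x p≢y p≢z)
      ... | no v≢y   | no v≢z   = trans (viaZ v≢a v≢x v≢y v≢z) (sym (viaZ p≢a p≢x p≢y p≢z))

    -- Otherwise the path `y`, `x`, `a`, `z`, `w` is rainbow.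
    sameColor : ∀ {x y z w} → Unique (a ∷ x ∷ y ∷ z ∷ w ∷ []) →
      color x y ≡ c → color z w ≡ d → color a z ≡ color a x
    sameColor {x} {y} {z} {w} vs! xy≡c zw≡d with color a z ≟ color a x
    ... | yes az≡ax = az≡ax
    ... | no az≢ax = ⊥-elim (clash 3F
      (fourthColor 2F 1F 0F 3F 4F 1F 0F 2F (reverse ⟨ xy≡c ⟩) (reverse ⟨ refl ⟩) ⟨ refl ⟩) ⟨ zw≡d ⟩)
      where
      x≢a = distinct vs! 1F 0F
      z≢a = distinct vs! 3F 0F
      open Configuration vs! {color a x ∷ c ∷ color a z ∷ d ∷ []}
        ( (¬c x x≢a ∷ ≢-sym az≢ax ∷ ¬d x x≢a ∷ [])
        ∷ (≢-sym (¬c z z≢a) ∷ c≢d ∷ []) ∷ (¬d z z≢a ∷ []) ∷ [] ∷ [])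

    -- All edges from `a` to the two given edges share one colour, so two further colours at `a`
    -- lead to new vertices `p` and `q`. Paths through these force that shared colour on `yz` and
    -- `xz`, and then no colour is left for `px`.
    disjoint : ∀ {x y z w} → Unique (a ∷ x ∷ y ∷ z ∷ w ∷ []) →
      color x y ≡ c → color z w ≢ d
    disjoint {x} {y} {z} {w} vs! xy≡c zw≡d
      -- Only one colour has to be avoided; it is repeated because `rich` takes exactly two.
      with p , p≢a , ap≢ax ∷ _ ∷ [] ← rich (color a x ∷ color a x ∷ [])
      with q , q≢a , aq≢ax ∷ aq≢ap ∷ [] ← rich (color a x ∷ color a p ∷ []) =
      impossible px
      where
      az≡ax : color a z ≡ color a x
      az≡ax = sameColor vs! xy≡c zw≡d

      aw≡ax : color a w ≡ color a x
      aw≡ax = sameColor (pick vs! (0F ∷ 1F ∷ 2F ∷ 4F ∷ 3F ∷ [])) xy≡c (trans (color-sym w z) zw≡d)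

      ay≡ax : color a y ≡ color a x
      ay≡ax = trans (sym (sameColor (pick vs! (0F ∷ 2F ∷ 1F ∷ 3F ∷ 4F ∷ [])) (trans (color-sym y x) xy≡c) zw≡d)) az≡ax

      outside : ∀ {v} → v ≢ a → color a v ≢ color a x → All (v ≢_) (a ∷ x ∷ y ∷ z ∷ w ∷ [])
      outside v≢a av≢ax = v≢a ∷ ≢-endpoint av≢ax
        ∷ (≢-endpoint λ e → av≢ax (trans e ay≡ax))
        ∷ (≢-endpoint λ e → av≢ax (trans e az≡ax))
        ∷ (≢-endpoint λ e → av≢ax (trans e aw≡ax)) ∷ []

      x≢a = distinct vs! 1F 0F

      -- The indices `0F` to `6F` stand for `q`, `p`, `a`, `x`, `y`, `z`, `w`.
      open Configuration ((≢-endpoint aq≢ap ∷ outside q≢a aq≢ax) ∷ outside p≢a ap≢ax ∷ vs!)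
        {color a x ∷ color a p ∷ color a q ∷ c ∷ d ∷ []}
        ( (≢-sym ap≢ax ∷ ≢-sym aq≢ax ∷ ¬c x x≢a ∷ ¬d x x≢a ∷ [])
        ∷ (≢-sym aq≢ap ∷ ¬c p p≢a ∷ ¬d p p≢a ∷ [])
        ∷ (¬c q q≢a ∷ ¬d q q≢a ∷ []) ∷ (c≢d ∷ []) ∷ [] ∷ [])

      yz : 4F — 5F ∶ 0F
      yz = only (meet
        (meet (fourthColor 1F 2F 3F 4F 5F 1F 0F 3F (reverse ⟨ refl ⟩) ⟨ refl ⟩ ⟨ xy≡c ⟩)
              (fourthColor 0F 2F 3F 4F 5F 2F 0F 3F (reverse ⟨ refl ⟩) ⟨ refl ⟩ ⟨ xy≡c ⟩))
        (reverse∈ (fourthColor 1F 2F 6F 5F 4F 1F 0F 4F (reverse ⟨ refl ⟩) ⟨ aw≡ax ⟩ (reverse ⟨ zw≡d ⟩))))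

      xz : 3F — 5F ∶ 0F
      xz = only (meet
        (meet (fourthColor 1F 2F 4F 3F 5F 1F 0F 3F (reverse ⟨ refl ⟩) ⟨ ay≡ax ⟩ (reverse ⟨ xy≡c ⟩))
              (fourthColor 0F 2F 4F 3F 5F 2F 0F 3F (reverse ⟨ refl ⟩) ⟨ ay≡ax ⟩ (reverse ⟨ xy≡c ⟩)))
        (reverse∈ (fourthColor 1F 2F 6F 5F 3F 1F 0F 4F (reverse ⟨ refl ⟩) ⟨ aw≡ax ⟩ (reverse ⟨ zw≡d ⟩))))

      px : 1F — 3F ∶∈ 0F ∷ 3F ∷ []
      px = meet
        (reverse∈ (fourthColor 6F 5F 4F 3F 1F 4F 0F 3F (reverse ⟨ zw≡d ⟩) (reverse yz) (reverse ⟨ xy≡c ⟩)))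
        (secondColor 2F 1F 3F 4F 5F 1F 3F 0F ⟨ refl ⟩ ⟨ xy≡c ⟩ yz)

      impossible : 1F — 3F ∶∈ 0F ∷ 3F ∷ [] → ⊥
      impossible (List.here px∶ax) =
        clash 3F (fourthColor 0F 2F 1F 3F 4F 2F 1F 0F (reverse ⟨ refl ⟩) ⟨ refl ⟩ px∶ax) ⟨ xy≡c ⟩
      impossible (List.there (List.here px∶c)) =
        clash 0F (fourthColor 0F 2F 1F 3F 5F 2F 1F 3F (reverse ⟨ refl ⟩) ⟨ refl ⟩ px∶c) xz

    impossible : 4 < n → ∀ {x y z w} → x ≢ y → z ≢ w → color x y ≡ c → color z w ≢ d
    impossible 4<n {x} {y} {z} {w} x≢y z≢w xy≡c zw≡d
      with x≢a , y≢a ← missing-avoids ¬c x≢y xy≡c | z≢a , w≢a ← missing-avoids ¬d z≢w zw≡d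
      with x ≟ z | x ≟ w | y ≟ z | y ≟ w
    ... | yes refl | _        | _        | yes refl = c≢d (trans (sym xy≡c) zw≡d)
    ... | yes refl | _        | _        | no y≢w   = adjacent 4<n x≢a y≢a w≢a x≢y z≢w y≢w xy≡c zw≡d
    ... | no _     | yes refl | yes refl | _        = c≢d (trans (sym xy≡c) (trans (color-sym x y) zw≡d))
    ... | no x≢z   | yes refl | no y≢z   | _        =
      adjacent 4<n x≢a y≢a z≢a x≢y x≢z y≢z xy≡c (trans (color-sym x z) zw≡d)
    ... | no _     | no x≢w   | yes refl | _        =
      adjacent 4<n y≢a x≢a w≢a (≢-sym x≢y) z≢w x≢w (trans (color-sym y x) xy≡c) zw≡d
    ... | no x≢z   | no _     | no y≢z   | yes refl =
      adjacent 4<n y≢a x≢a z≢a (≢-sym x≢y) y≢z x≢z (trans (color-sym y x) xy≡c) (trans (color-sym y z) zw≡d)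
    ... | no x≢z   | no x≢w   | no y≢z   | no y≢w   = disjoint
      ( (≢-sym x≢a ∷ ≢-sym y≢a ∷ ≢-sym z≢a ∷ ≢-sym w≢a ∷ []) ∷ (x≢y ∷ x≢z ∷ x≢w ∷ [])
      ∷ (y≢z ∷ y≢w ∷ []) ∷ (z≢w ∷ []) ∷ [] ∷ []) xy≡c zw≡d

  -- A vertex seeing at least three colours: the rest is monochromatic.

  MonochromaticOff : Fin n → Fin k → Set
  MonochromaticOff a c = ∀ {u v} → u ≢ a → v ≢ a → u ≢ v → color u v ≡ c

  Spreads : Fin n → Fin k → Set
  Spreads a c = ∀ {x y w} → Unique (a ∷ x ∷ y ∷ w ∷ []) → color x y ≡ c → color y w ≡ c

  -- The colour passes from `xy` to all edges at `x`, and from `xu` to all edges at `u`, always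
  -- avoiding `a`.
  spreads⇒monochromatic : ∀ {a c x y} → Spreads a c → x ≢ a → y ≢ a → x ≢ y → color x y ≡ c →
    MonochromaticOff a c
  spreads⇒monochromatic {a} {c} {x} {y} spreads x≢a y≢a x≢y xy≡c {u} {v} u≢a v≢a u≢v = edge
    where
    star : ∀ {w} → w ≢ a → w ≢ x → color x w ≡ c
    star {w} w≢a w≢x with w ≟ y
    ... | yes refl = xy≡c
    ... | no w≢y = spreads
      ((≢-sym y≢a ∷ ≢-sym x≢a ∷ ≢-sym w≢a ∷ []) ∷ (≢-sym x≢y ∷ ≢-sym w≢y ∷ []) ∷ (≢-sym w≢x ∷ []) ∷ [] ∷ [])
      (trans (color-sym y x) xy≡c)

    edge : color u v ≡ c
    edge with u ≟ x | v ≟ x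
    ... | yes refl | _        = star v≢a (≢-sym u≢v)
    ... | no u≢x   | yes refl = trans (color-sym u x) (star u≢a u≢x)
    ... | no u≢x   | no v≢x   = spreads
      ((≢-sym x≢a ∷ ≢-sym u≢a ∷ ≢-sym v≢a ∷ []) ∷ (≢-sym u≢x ∷ ≢-sym v≢x ∷ []) ∷ (u≢v ∷ []) ∷ [] ∷ [])
      (star u≢a u≢x)

  module OneMissingColor {a} (rich : Rich a 3) {c} (¬c : Missing a c) where

    module _ {x y w d} (vs! : Unique (a ∷ x ∷ y ∷ w ∷ [])) (xy≡c : color x y ≡ c)
      (yw≡d : color y w ≡ d) (d≢c : d ≢ c) where

      private
        x≢a = distinct vs! 1F 0F
        y≢a = distinct vs! 2F 0F
        w≢a = distinct vs! 3F 0F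

        -- Otherwise the path `x`, `y`, `w`, `a`, `v` is rainbow.
        aroundW : color a w ≢ d → ∀ {v} → All (v ≢_) (a ∷ x ∷ y ∷ w ∷ []) → color a v ≢ color a w →
          color a v ≡ d
        aroundW aw≢d {v} v∉ av≢aw with color a v ≟ d
        ... | yes av≡d = av≡d
        ... | no av≢d = ⊥-elim (clash 3F
          (fourthColor 2F 3F 4F 1F 0F 0F 1F 2F ⟨ xy≡c ⟩ ⟨ yw≡d ⟩ (reverse ⟨ refl ⟩)) ⟨ refl ⟩)
          where
          open Configuration (v∉ ∷ vs!) {c ∷ d ∷ color a w ∷ color a v ∷ []}
            ( (≢-sym d≢c ∷ ≢-sym (¬c w w≢a) ∷ ≢-sym (¬c v (All.head v∉)) ∷ [])
            ∷ (≢-sym aw≢d ∷ ≢-sym av≢d ∷ []) ∷ (≢-sym av≢aw ∷ []) ∷ [] ∷ [])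

      -- If not, `aroundW` forces the witnesses `u` and `v` to be `x` and `y`. Then the colours of
      -- `ax`, `ay`, `aw` together with `d` and `c` are distinct, and three paths ending in the edge
      -- `wp` leave no colour for it.
      aw≡d : color a w ≡ d
      aw≡d with color a w ≟ d
      ... | yes aw≡d = aw≡d
      ... | no aw≢d
        with p , p≢a , ap≢ax ∷ ap≢ay ∷ ap≢aw ∷ [] ← rich (color a x ∷ color a y ∷ color a w ∷ [])
           | u , u≢a , au≢d ∷ au≢ay ∷ au≢aw ∷ [] ← rich (d ∷ color a y ∷ color a w ∷ [])
           | v , v≢a , av≢d ∷ av≢ax ∷ av≢aw ∷ [] ← rich (d ∷ color a x ∷ color a w ∷ [])
        with u ≟ x | v ≟ y
      ... | no u≢x   | _        = contradiction
        (aroundW aw≢d (u≢a ∷ u≢x ∷ ≢-endpoint au≢ay ∷ ≢-endpoint au≢aw ∷ []) au≢aw) au≢d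
      ... | yes _    | no v≢y   = contradiction
        (aroundW aw≢d (v≢a ∷ ≢-endpoint av≢ax ∷ v≢y ∷ ≢-endpoint av≢aw ∷ []) av≢aw) av≢d
      ... | yes refl | yes refl = ⊥-elim (clash 0F
        (fourthColor 2F 3F 1F 4F 0F 4F 1F 2F ⟨ xy≡c ⟩ (reverse ⟨ refl ⟩) ⟨ refl ⟩)
        (only (meet
          (fourthColor 2F 1F 3F 4F 0F 0F 1F 3F (reverse ⟨ refl ⟩) ⟨ refl ⟩ ⟨ yw≡d ⟩)
          (fourthColor 3F 2F 1F 4F 0F 4F 0F 2F (reverse ⟨ xy≡c ⟩) (reverse ⟨ refl ⟩) ⟨ refl ⟩))))
        where
        p∉ : All (p ≢_) (a ∷ x ∷ y ∷ w ∷ [])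
        p∉ = p≢a ∷ ≢-endpoint ap≢ax ∷ ≢-endpoint ap≢ay ∷ ≢-endpoint ap≢aw ∷ []

        open Configuration (p∉ ∷ vs!) {color a x ∷ color a y ∷ color a w ∷ d ∷ c ∷ []}
          ( (≢-sym av≢ax ∷ au≢aw ∷ au≢d ∷ ¬c x x≢a ∷ [])
          ∷ (av≢aw ∷ av≢d ∷ ¬c y y≢a ∷ []) ∷ (aw≢d ∷ ¬c w w≢a ∷ []) ∷ (d≢c ∷ []) ∷ [] ∷ [])

      -- Otherwise a vertex `p` with a new colour at `a` makes the path `p`, `a`, `x`, `y`, `w`
      -- rainbow.
      ax≡d : color a x ≡ d
      ax≡d with color a x ≟ d
      ... | yes ax≡d = ax≡d
      ... | no ax≢d
        with p , p≢a , ap≢d ∷ ap≢ax ∷ ap≢ay ∷ [] ← rich (d ∷ color a x ∷ color a y ∷ []) =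
        ⊥-elim (clash 3F (fourthColor 0F 1F 2F 3F 4F 0F 1F 2F (reverse ⟨ refl ⟩) ⟨ refl ⟩ ⟨ xy≡c ⟩) ⟨ yw≡d ⟩)
        where
        p≢w : p ≢ w
        p≢w = ≢-endpoint λ ap≡aw → ap≢d (trans ap≡aw aw≡d)

        open Configuration ((p≢a ∷ ≢-endpoint ap≢ax ∷ ≢-endpoint ap≢ay ∷ p≢w ∷ []) ∷ vs!)
          {color a p ∷ color a x ∷ c ∷ d ∷ []}
          ( (ap≢ax ∷ ¬c p p≢a ∷ ap≢d ∷ []) ∷ (¬c x x≢a ∷ ax≢d ∷ []) ∷ (≢-sym d≢c ∷ []) ∷ [] ∷ [])

    -- If `yw` is not coloured `c`, then `ax` and `aw` have its colour. For `p` with a new colour at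
    -- `a`, the edge `yp` must be coloured `c`, or else `ap` and `ax` would agree in the same way. A
    -- further `q` makes the path `w`, `y`, `p`, `a`, `q` rainbow.
    spreads : Spreads a c
    spreads {x} {y} {w} vs! xy≡c with color y w ≟ c
    ... | yes yw≡c = yw≡c
    ... | no yw≢c
      with p , p≢a , ap≢ax ∷ ap≢ay ∷ _ ∷ [] ← rich (color a x ∷ color a y ∷ color a y ∷ [])
      with q , q≢a , aq≢ax ∷ aq≢ay ∷ aq≢ap ∷ [] ← rich (color a x ∷ color a y ∷ color a p ∷ []) =
      ⊥-elim (clash 3F (fourthColor 5F 4F 1F 2F 0F 0F 1F 2F (reverse ⟨ refl ⟩) yp (reverse ⟨ refl ⟩)) ⟨ refl ⟩)
      where
      ax≡yw = ax≡d vs! xy≡c refl yw≢c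
      aw≡ax = trans (aw≡d vs! xy≡c refl yw≢c) (sym ax≡yw)

      outside : ∀ {v} → v ≢ a → color a v ≢ color a x → color a v ≢ color a y →
        All (v ≢_) (a ∷ x ∷ y ∷ w ∷ [])
      outside v≢a av≢ax av≢ay = v≢a ∷ ≢-endpoint av≢ax ∷ ≢-endpoint av≢ay
        ∷ (≢-endpoint λ av≡aw → av≢ax (trans av≡aw aw≡ax)) ∷ []

      pvs! : Unique (p ∷ a ∷ x ∷ y ∷ w ∷ [])
      pvs! = outside p≢a ap≢ax ap≢ay ∷ vs!

      open Configuration ((≢-endpoint aq≢ap ∷ outside q≢a aq≢ax aq≢ay) ∷ pvs!)
        {color y w ∷ c ∷ color a p ∷ color a q ∷ []}
        ( (yw≢c ∷ (λ e → ap≢ax (sym (trans ax≡yw e))) ∷ (λ e → aq≢ax (sym (trans ax≡yw e))) ∷ [])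
        ∷ (≢-sym (¬c p p≢a) ∷ ≢-sym (¬c q q≢a) ∷ []) ∷ (≢-sym aq≢ap ∷ []) ∷ [] ∷ [])

      yp : 4F — 1F ∶ 1F
      yp with color y p ≟ c
      ... | yes yp≡c = ⟨ yp≡c ⟩
      ... | no yp≢c = contradiction
        (trans (aw≡d axyp! xy≡c refl yp≢c) (sym (ax≡d axyp! xy≡c refl yp≢c))) ap≢ax
        where
        axyp! : Unique (a ∷ x ∷ y ∷ p ∷ [])
        axyp! = pick pvs! (1F ∷ 2F ∷ 3F ∷ 0F ∷ [])

  module AllColorsPresent {a} (rich : Rich a 4) where

    module _ {x y w c d} (vs! : Unique (a ∷ x ∷ y ∷ w ∷ [])) (xy≡c : color x y ≡ c)
      (yw≡d : color y w ≡ d) (c≢d : c ≢ d) where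

      private
        -- Otherwise the path `v`, `a`, `x`, `y`, `w` is rainbow.
        aroundX : color a x ≢ c → color a x ≢ d → ∀ {v} → All (v ≢_) (a ∷ x ∷ y ∷ w ∷ []) →
          color a v ≢ color a x → color a v ≢ c → color a v ≡ d
        aroundX ax≢c ax≢d {v} v∉ av≢ax av≢c with color a v ≟ d
        ... | yes av≡d = av≡d
        ... | no av≢d = ⊥-elim (clash 3F
          (fourthColor 0F 1F 2F 3F 4F 0F 1F 2F (reverse ⟨ refl ⟩) ⟨ refl ⟩ ⟨ xy≡c ⟩) ⟨ yw≡d ⟩)
          where
          open Configuration (v∉ ∷ vs!) {color a v ∷ color a x ∷ c ∷ d ∷ []}
            ((av≢ax ∷ av≢c ∷ av≢d ∷ []) ∷ (ax≢c ∷ ax≢d ∷ []) ∷ (c≢d ∷ []) ∷ [] ∷ [])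

      -- If not, `aroundX` forces the witnesses `u` and `v` to be `w` and `y`, and gives `aq` the
      -- colour `d`. Then `xw` can only be coloured `c` or `d`, and in either case the paths ending
      -- in `yp` leave no colour for that edge.
      ax≡c⊎ax≡d : color a x ≡ c ⊎ color a x ≡ d
      ax≡c⊎ax≡d with color a x ≟ c | color a x ≟ d
      ... | yes ax≡c | _        = inj₁ ax≡c
      ... | no _     | yes ax≡d = inj₂ ax≡d
      ... | no ax≢c  | no ax≢d
        with u , u≢a , au≢ax ∷ au≢ay ∷ au≢c ∷ au≢d ∷ [] ← rich (color a x ∷ color a y ∷ c ∷ d ∷ [])
           | v , v≢a , av≢ax ∷ av≢aw ∷ av≢c ∷ av≢d ∷ [] ← rich (color a x ∷ color a w ∷ c ∷ d ∷ [])
           | p , p≢a , ap≢ax ∷ ap≢ay ∷ ap≢aw ∷ ap≢d ∷ [] ← rich (color a x ∷ color a y ∷ color a w ∷ d ∷ [])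
           | q , q≢a , aq≢ax ∷ aq≢ay ∷ aq≢aw ∷ aq≢c ∷ [] ← rich (color a x ∷ color a y ∷ color a w ∷ c ∷ [])
        with u ≟ w | v ≟ y
      ... | no u≢w   | _        = contradiction
        (aroundX ax≢c ax≢d (u≢a ∷ ≢-endpoint au≢ax ∷ ≢-endpoint au≢ay ∷ u≢w ∷ []) au≢ax au≢c) au≢d
      ... | yes _    | no v≢y   = contradiction
        (aroundX ax≢c ax≢d (v≢a ∷ ≢-endpoint av≢ax ∷ v≢y ∷ ≢-endpoint av≢aw ∷ []) av≢ax av≢c) av≢d
      ... | yes refl | yes refl = ⊥-elim (impossible xw)
        where
        p∉ : All (p ≢_) (a ∷ x ∷ y ∷ w ∷ [])
        p∉ = p≢a ∷ ≢-endpoint ap≢ax ∷ ≢-endpoint ap≢ay ∷ ≢-endpoint ap≢aw ∷ []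

        q∉ : All (q ≢_) (a ∷ x ∷ y ∷ w ∷ [])
        q∉ = q≢a ∷ ≢-endpoint aq≢ax ∷ ≢-endpoint aq≢ay ∷ ≢-endpoint aq≢aw ∷ []

        aq≡d : color a q ≡ d
        aq≡d = aroundX ax≢c ax≢d q∉ aq≢ax aq≢c

        open Configuration ((≢-endpoint (λ aq≡ap → ap≢d (trans (sym aq≡ap) aq≡d)) ∷ q∉) ∷ p∉ ∷ vs!)
          {color a x ∷ color a y ∷ color a w ∷ c ∷ d ∷ []}
          ( (≢-sym av≢ax ∷ ≢-sym au≢ax ∷ ax≢c ∷ ax≢d ∷ [])
          ∷ (av≢aw ∷ av≢c ∷ av≢d ∷ []) ∷ (au≢c ∷ au≢d ∷ []) ∷ (c≢d ∷ []) ∷ [] ∷ [])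

        xw : 3F — 5F ∶∈ 4F ∷ 3F ∷ []
        xw = meet
          (fourthColor 0F 2F 4F 3F 5F 4F 1F 3F (reverse ⟨ aq≡d ⟩) ⟨ refl ⟩ (reverse ⟨ xy≡c ⟩))
          (secondColor 4F 3F 5F 2F 0F 3F 2F 4F (reverse ⟨ xy≡c ⟩) (reverse ⟨ refl ⟩) ⟨ aq≡d ⟩)

        impossible : 3F — 5F ∶∈ 4F ∷ 3F ∷ [] → ⊥
        impossible (List.here xw∶d) = clash 0F
          (fourthColor 3F 5F 2F 4F 1F 4F 2F 1F xw∶d (reverse ⟨ refl ⟩) ⟨ refl ⟩)
          (only (meet
            (fourthColor 5F 3F 2F 4F 1F 4F 0F 1F (reverse xw∶d) (reverse ⟨ refl ⟩) ⟨ refl ⟩)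
            (fourthColor 5F 2F 3F 4F 1F 2F 0F 3F (reverse ⟨ refl ⟩) ⟨ refl ⟩ ⟨ xy≡c ⟩)))
        impossible (List.there (List.here xw∶c)) = clash 0F
          (fourthColor 3F 5F 2F 4F 1F 3F 2F 1F xw∶c (reverse ⟨ refl ⟩) ⟨ refl ⟩)
          (only (meet
            (fourthColor 5F 3F 2F 4F 1F 3F 0F 1F (reverse xw∶c) (reverse ⟨ refl ⟩) ⟨ refl ⟩)
            (fourthColor 3F 2F 5F 4F 1F 0F 2F 4F (reverse ⟨ refl ⟩) ⟨ refl ⟩ (reverse ⟨ yw≡d ⟩))))

    aw≡c⊎aw≡d : ∀ {x y w c d} → Unique (a ∷ x ∷ y ∷ w ∷ []) → color x y ≡ c → color y w ≡ d →
      c ≢ d → color a w ≡ c ⊎ color a w ≡ d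
    aw≡c⊎aw≡d vs! xy≡c yw≡d c≢d = swap (ax≡c⊎ax≡d (pick vs! (0F ∷ 3F ∷ 2F ∷ 1F ∷ []))
      (trans (color-sym _ _) yw≡d) (trans (color-sym _ _) xy≡c) (≢-sym c≢d))

    -- The two preceding lemmas, applied to paths ending in `p`, force `yp` to have the colour of
    -- `ap`. Applied inside the triangle `x`, `y`, `p`, they then decide `ay`, whether or not `xp`
    -- is coloured `c`.
    ay≡c⊎ay≡ap : ∀ {p x y w c d} → Unique (p ∷ a ∷ x ∷ y ∷ w ∷ []) →
      color x y ≡ c → color y w ≡ d → c ≢ d → color a p ≢ c → color a p ≢ d →
      color a y ≡ c ⊎ color a y ≡ color a p
    ay≡c⊎ay≡ap {p} {x} {y} {w} {c} {d} vs! xy≡c yw≡d c≢d ap≢c ap≢d = cases (color x p ≟ c)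
      where
      or-c : color a p ≡ c ⊎ color a p ≡ color y p → color y p ≡ color a p
      or-c = [ (λ ap≡c → contradiction ap≡c ap≢c) , sym ]′

      yp≡ap : color y p ≡ color a p
      yp≡ap with color y p ≟ c
      ... | no yp≢c = or-c (aw≡c⊎aw≡d (pick vs! (1F ∷ 2F ∷ 3F ∷ 0F ∷ [])) xy≡c refl (≢-sym yp≢c))
      ... | yes yp≡c = ⊥-elim ([ ap≢d , ap≢c ]′
        (aw≡c⊎aw≡d (pick vs! (1F ∷ 4F ∷ 3F ∷ 0F ∷ [])) (trans (color-sym w y) yw≡d) yp≡c (≢-sym c≢d)))

      cases : Dec (color x p ≡ c) → color a y ≡ c ⊎ color a y ≡ color a p
      cases (yes xp≡c) = aw≡c⊎aw≡d (pick vs! (1F ∷ 2F ∷ 0F ∷ 3F ∷ [])) xp≡c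
        (trans (color-sym p y) yp≡ap) (≢-sym ap≢c)
      cases (no xp≢c)
        with aw≡c⊎aw≡d yxp! yx≡c refl (≢-sym xp≢c) | ax≡c⊎ax≡d yxp! yx≡c refl (≢-sym xp≢c)
        where
        yxp! : Unique (a ∷ y ∷ x ∷ p ∷ [])
        yxp! = pick vs! (1F ∷ 3F ∷ 2F ∷ 0F ∷ [])
        yx≡c = trans (color-sym y x) xy≡c
      ... | inj₁ ap≡c  | _          = contradiction ap≡c ap≢c
      ... | inj₂ _     | inj₁ ay≡c  = inj₁ ay≡c
      ... | inj₂ ap≡xp | inj₂ ay≡xp = inj₂ (trans ay≡xp (sym ap≡xp))

    -- Take `p` with a new colour at `a`. Then `ay≡c⊎ay≡ap`, used once as it stands and once with
    -- `x` and `w` exchanged, gives `ay` both the colour `c` and the colour of `yw`.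
    spreads : ∀ c → Spreads a c
    spreads c {x} {y} {w} vs! xy≡c with color y w ≟ c
    ... | yes yw≡c = yw≡c
    ... | no yw≢c
      with p , p≢a , ap≢ay ∷ ap≢c ∷ ap≢yw ∷ _ ∷ [] ← rich (color a y ∷ c ∷ color y w ∷ c ∷ []) =
      contradiction (trans (sym ay≡c) ay≡yw) (≢-sym yw≢c)
      where
      elsewhere : ∀ {v} → color a v ≡ c ⊎ color a v ≡ color y w → p ≢ v
      elsewhere = ≢-endpoint ∘ [ (λ av≡c ap≡av → ap≢c (trans ap≡av av≡c))
                               , (λ av≡yw ap≡av → ap≢yw (trans ap≡av av≡yw)) ]′

      p∉ : All (p ≢_) (a ∷ x ∷ y ∷ w ∷ [])
      p∉ = p≢a ∷ elsewhere (ax≡c⊎ax≡d vs! xy≡c refl (≢-sym yw≢c)) ∷ ≢-endpoint ap≢ay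
        ∷ elsewhere (aw≡c⊎aw≡d vs! xy≡c refl (≢-sym yw≢c)) ∷ []

      ay≡c : color a y ≡ c
      ay≡c with ay≡c⊎ay≡ap (p∉ ∷ vs!) xy≡c refl (≢-sym yw≢c) ap≢c ap≢yw
      ... | inj₁ ay≡c  = ay≡c
      ... | inj₂ ay≡ap = contradiction (sym ay≡ap) ap≢ay

      ay≡yw : color a y ≡ color y w
      ay≡yw with ay≡c⊎ay≡ap (pick (p∉ ∷ vs!) (0F ∷ 1F ∷ 4F ∷ 3F ∷ 2F ∷ []))
        (color-sym w y) (trans (color-sym y x) xy≡c) yw≢c ap≢yw ap≢c
      ... | inj₁ ay≡yw = ay≡yw
      ... | inj₂ ay≡ap = contradiction (sym ay≡ap) ap≢ay

  2coloredAt? : Decidable (2ColoredAt color)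
  2coloredAt? a = any? λ c → any? λ d → all? λ v → ¬? (v ≟ a) →-dec (color a v ≟ c ⊎-dec color a v ≟ d)

  ¬2colored⇒rich : ∀ {a} → ¬ 2ColoredAt color a → Rich a 2
  ¬2colored⇒rich {a} ¬2colored (c ∷ d ∷ []) = decidable-stable
    (any? λ v → ¬? (v ≟ a) ×-dec All.all? (λ c → ¬? (color a v ≟ c)) (c ∷ d ∷ []))
    λ ¬third → ¬2colored (c , d , λ v v≢a → decidable-stable (color a v ≟ c ⊎-dec color a v ≟ d)
      λ ¬cd → ¬third (v , v≢a , ¬cd ∘ inj₁ ∷ ¬cd ∘ inj₂ ∷ []))

  module _ (4<n : 4 < n) (4<k : 4 < k) (exact : ∀ c → ∃[ u ] ∃[ v ] u ≢ v × color u v ≡ c) where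

    seen? : ∀ a c → Dec (∃[ v ] v ≢ a × color a v ≡ c)
    seen? a c = any? λ v → ¬? (v ≟ a) ×-dec color a v ≟ c

    -- If no colour is missing, all of the at least five colours occur at `a`. If `c` is missing, a
    -- second missing colour is excluded by `TwoMissingColors`, with edges supplied by exactness, so
    -- at least four colours occur at `a`.
    rich⇒monochromatic : ∀ a → Rich a 2 → ∃[ c ] MonochromaticOff a c
    rich⇒monochromatic a rich₂ with any? (¬? ∘ seen? a)
    ... | no ¬missing
      with x , x≢a ∷ _ ∷ [] ← avoid (ℕ.≤-trans (s≤s (s≤s (s≤s z≤n))) 4<n) (a ∷ a ∷ [])
      with y , y≢a ∷ y≢x ∷ [] ← avoid (ℕ.≤-trans (s≤s (s≤s (s≤s z≤n))) 4<n) (a ∷ x ∷ []) =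
      color x y , spreads⇒monochromatic (AllColorsPresent.spreads rich₄ (color x y)) x≢a y≢a (≢-sym y≢x) refl
      where
      rich₄ : Rich a 4
      rich₄ cs with d , d∉ ← avoid 4<k cs
        with v , v≢a , refl ← decidable-stable (seen? a d) (¬missing ∘ (d ,_)) = v , v≢a , d∉
    ... | yes (c , ¬seen-c) with x , y , x≢y , xy≡c ← exact c = c , mono
      where
      ¬c : Missing a c
      ¬c v v≢a av≡c = ¬seen-c (v , v≢a , av≡c)

      rich₃ : Rich a 3
      rich₃ cs with d , d≢c ∷ d∉ ← avoid 4<k (c ∷ cs)
        with seen? a d
      ... | yes (v , v≢a , refl) = v , v≢a , d∉
      ... | no ¬seen-d with z , w , z≢w , zw≡d ← exact d =
        ⊥-elim (TwoMissingColors.impossible rich₂ (≢-sym d≢c) ¬c (λ v v≢a av≡d → ¬seen-d (v , v≢a , av≡d))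
          4<n x≢y z≢w xy≡c zw≡d)

      mono : MonochromaticOff a c
      mono with x≢a , y≢a ← missing-avoids ¬c x≢y xy≡c =
        spreads⇒monochromatic (OneMissingColor.spreads rich₃ ¬c) x≢a y≢a x≢y xy≡c

    monochromatic⊎2colored : (∃[ a ] ∃[ c ] MonochromaticOff a c) ⊎ (∀ a → 2ColoredAt color a)
    monochromatic⊎2colored with any? (¬? ∘ 2coloredAt?)
    ... | yes (a , ¬2colored) = inj₁ (a , rich⇒monochromatic a (¬2colored⇒rich ¬2colored))
    ... | no ¬rich = inj₂ λ a → decidable-stable (2coloredAt? a) (¬rich ∘ (a ,_))

-- Colourings in which every vertex sees at most two colours.

record DominantColor {n k} (color : Fin n → Fin n → Fin k) : Set where
  field
    dominant : Fin k
    other    : Fin n → Fin k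
    -- In a symmetric colouring this applies at both ends, so an edge that is not dominant joins
    -- vertices with the same `other` colour.
    palette  : ∀ {u v} → u ≢ v → color u v ≡ dominant ⊎ color u v ≡ other u

module _ {n k : ℕ} (color : Fin n → Fin n → Fin k) (color-sym : ∀ u v → color u v ≡ color v u)
  (4<k : 4 < k) (exact : ∀ c → ∃[ u ] ∃[ v ] u ≢ v × color u v ≡ c)
  (2colored : ∀ a → 2ColoredAt color a) where

  private
    -- Membership in the chosen pair of `v`; the colour need not occur on an edge at `v`.
    _∈_ : Fin k → Fin n → Set
    c ∈ v = c ≡ proj₁ (2colored v) ⊎ c ≡ proj₁ (proj₂ (2colored v))

    atMostTwo : ∀ {v x y z} → x ∈ v → y ∈ v → x ≢ y → z ∈ v → z ≡ x ⊎ z ≡ y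
    atMostTwo (inj₁ refl) (inj₁ refl) x≢y _           = contradiction refl x≢y
    atMostTwo (inj₁ refl) (inj₂ refl) x≢y z∈v         = z∈v
    atMostTwo (inj₂ refl) (inj₁ refl) x≢y z∈v         = swap z∈v
    atMostTwo (inj₂ refl) (inj₂ refl) x≢y _           = contradiction refl x≢y

    incident : ∀ {u v} → u ≢ v → color u v ∈ u
    incident {u} {v} u≢v = proj₂ (proj₂ (2colored u)) v (≢-sym u≢v)

    meeting : ∀ u v → ∃[ c ] c ∈ u × c ∈ v
    meeting u v with u ≟ v
    ... | yes refl = proj₁ (2colored u) , inj₁ refl , inj₁ refl
    ... | no u≢v with incident u≢v | incident (≢-sym u≢v)
    ...   | uv∈u | vu∈v rewrite color-sym v u = color u v , uv∈u , vu∈v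

    notThree : ∀ {v x y z} → x ∈ v → y ∈ v → z ∈ v → x ≢ y → z ≢ x → z ≢ y → ⊥
    notThree x∈v y∈v z∈v x≢y z≢x z≢y = [ z≢x , z≢y ]′ (atMostTwo x∈v y∈v x≢y z∈v)

    seen : ∀ c → ∃[ v ] c ∈ v
    seen c with u , v , u≢v , refl ← exact c = u , incident u≢v

  -- The colour pairs at the vertices intersect pairwise and use more than three
  -- colours, so they form a star rather than a triangle.
  commonColor : ∃[ s ] ∀ v → s ∈ v
  commonColor
    with c , _ ← avoid (ℕ.≤-trans (s≤s z≤n) 4<k) []
    with u , _ ← seen c
    with e , e≢u₁ ∷ e≢u₂ ∷ [] ← avoid (ℕ.≤-trans (s≤s (s≤s (s≤s z≤n))) 4<k)
      (proj₁ (2colored u) ∷ proj₁ (proj₂ (2colored u)) ∷ [])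
    with f , f≢u₁ ∷ f≢u₂ ∷ f≢e ∷ [] ← avoid (ℕ.≤-trans (s≤s (s≤s (s≤s (s≤s z≤n)))) 4<k)
      (proj₁ (2colored u) ∷ proj₁ (proj₂ (2colored u)) ∷ e ∷ [])
    with w , e∈w ← seen e | x , f∈x ← seen f
    with s , s∈u , s∈w ← meeting u w = s , everywhere
    where
    outside : ∀ {a b} → a ≢ proj₁ (2colored u) → a ≢ proj₁ (proj₂ (2colored u)) → b ∈ u → a ≢ b
    outside a≢u₁ a≢u₂ (inj₁ refl) = a≢u₁
    outside a≢u₁ a≢u₂ (inj₂ refl) = a≢u₂

    e≢s : e ≢ s
    e≢s = outside e≢u₁ e≢u₂ s∈u

    f≢s : f ≢ s
    f≢s = outside f≢u₁ f≢u₂ s∈u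

    -- The pair at `w` consists of `e` and `s`. If the pair at `x` met it in `e`, it would contain
    -- `e`, `f` and a third colour from the pair at `u`.
    s∈x : s ∈ x
    s∈x with r , r∈w , r∈x ← meeting w x with atMostTwo e∈w s∈w e≢s r∈w
    ... | inj₂ refl = r∈x
    ... | inj₁ refl with t , t∈u , t∈x ← meeting u x =
      ⊥-elim (notThree r∈x f∈x t∈x (≢-sym f≢e) (≢-sym (outside e≢u₁ e≢u₂ t∈u)) (≢-sym (outside f≢u₁ f≢u₂ t∈u)))

    -- A pair avoiding `s` would meet those at `w` and `x` in `e` and `f`, and the one at `u` in a
    -- third colour.
    everywhere : ∀ v → s ∈ v
    everywhere v
      with α , α∈w , α∈v ← meeting w v | β , β∈x , β∈v ← meeting x v | γ , γ∈u , γ∈v ← meeting u v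
      with atMostTwo e∈w s∈w e≢s α∈w | atMostTwo f∈x s∈x f≢s β∈x
    ... | inj₂ refl | _         = α∈v
    ... | inj₁ _    | inj₂ refl = β∈v
    ... | inj₁ refl | inj₁ refl = ⊥-elim (notThree α∈v β∈v γ∈v (≢-sym f≢e)
      (≢-sym (outside e≢u₁ e≢u₂ γ∈u)) (≢-sym (outside f≢u₁ f≢u₂ γ∈u)))

  dominantColor : DominantColor color
  dominantColor with s , s∈ ← commonColor = record
    { dominant = s
    ; other    = λ v → other (s∈ v)
    ; palette  = λ {u} {v} u≢v → palette (s∈ u) (incident u≢v)
    }
    where
    other : ∀ {v s} → s ∈ v → Fin k
    other {v} (inj₁ _) = proj₁ (proj₂ (2colored v))
    other {v} (inj₂ _) = proj₁ (2colored v)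

    palette : ∀ {v s c} (s∈v : s ∈ v) → c ∈ v → c ≡ s ⊎ c ≡ other s∈v
    palette (inj₁ refl) c∈v = c∈v
    palette (inj₂ refl) c∈v = swap c∈v

-- Counting the orbits of an involution.

record Enumeration {n} (P : Fin n → Set) : Set where
  field
    size      : ℕ
    element   : Fin size → Fin n
    injective : Injective _≡_ _≡_ element
    sound     : ∀ i → P (element i)
    complete  : ∀ {v} → P v → ∃[ i ] element i ≡ v

enumerate : ∀ {n} {P : Fin n → Set} → Decidable P → Enumeration P
enumerate {ℕ.zero} P? = record
  { size = 0 ; element = λ () ; injective = λ { {()} } ; sound = λ () ; complete = λ { {()} } }
enumerate {suc n} {P} P? with P? zero | enumerate (P? ∘ suc)
... | no ¬p₀ | rest = record
  { size      = size
  ; element   = suc ∘ element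
  ; injective = injective ∘ Fin.suc-injective
  ; sound     = sound
  ; complete  = λ { {zero} p₀ → contradiction p₀ ¬p₀
                  ; {suc v} pᵥ → let i , eq = complete pᵥ in i , cong suc eq }
  }
  where open Enumeration rest
... | yes p₀ | rest = record
  { size      = suc size
  ; element   = λ { zero → zero ; (suc i) → suc (element i) }
  ; injective = λ { {zero} {zero} _ → refl ; {suc i} {suc j} eq → cong suc (injective (Fin.suc-injective eq)) }
  ; sound     = λ { zero → p₀ ; (suc i) → sound i }
  ; complete  = λ { {zero} _ → zero , refl
                  ; {suc v} pᵥ → let i , eq = complete pᵥ in suc i , cong suc eq }
  }
  where open Enumeration rest

module Involution {t} (σ : Fin t → Fin t) (involutive : ∀ v → σ (σ v) ≡ v)
  (fixed-unique : ∀ {u v} → σ u ≡ u → σ v ≡ v → u ≡ v) where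

  -- Selects the smaller element of each orbit of `σ`, a fixed point included, so that `size` below
  -- is the number of orbits.
  Lower : Fin t → Set
  Lower v = v Fin.≤ σ v

  lower? : Decidable Lower
  lower? v = v Fin.≤? σ v

  lower-σ : ∀ {v} → ¬ Lower v → Lower (σ v)
  lower-σ {v} v≰σv = Fin.≤-trans (ℕ.<⇒≤ (ℕ.≰⇒> v≰σv)) (Fin.≤-reflexive (sym (involutive v)))

  lower-both : ∀ {v} → Lower v → Lower (σ v) → σ v ≡ v
  lower-both {v} v≤σv σv≤v = Fin.≤-antisym (Fin.≤-trans σv≤v (Fin.≤-reflexive (involutive v))) v≤σv

  open Enumeration (enumerate lower?)

  -- The lower elements and their partners are distinct, except that a fixed point would be
  -- counted twice; its second copy is sent to the spare value zero.
  spread : Fin size ⊎ Fin size → Fin (suc t)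
  spread (inj₁ i) = suc (element i)
  spread (inj₂ i) with σ (element i) ≟ element i
  ... | yes _ = zero
  ... | no _  = suc (σ (element i))

  mixed : ∀ i j → spread (inj₁ i) ≢ spread (inj₂ j)
  mixed i j eq with σ (element j) ≟ element j
  mixed i j () | yes _
  ... | no unfixed = unfixed (lower-both (sound j)
    (subst Lower (Fin.suc-injective eq) (sound i)))

  spread-injective : ∀ x y → spread x ≡ spread y → x ≡ y
  spread-injective (inj₁ i) (inj₁ j) eq = cong inj₁ (injective (Fin.suc-injective eq))
  spread-injective (inj₁ i) (inj₂ j) eq = contradiction eq (mixed i j)
  spread-injective (inj₂ i) (inj₁ j) eq = contradiction (sym eq) (mixed j i)
  spread-injective (inj₂ i) (inj₂ j) eq with σ (element i) ≟ element i | σ (element j) ≟ element j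
  ... | yes fixedᵢ | yes fixedⱼ = cong inj₂ (injective (fixed-unique fixedᵢ fixedⱼ))
  ... | no _       | no _ = cong inj₂ (injective (trans (sym (involutive _)) (trans (cong σ (Fin.suc-injective eq)) (involutive _))))
  spread-injective (inj₂ i) (inj₂ j) () | yes _ | no _
  spread-injective (inj₂ i) (inj₂ j) () | no _ | yes _

  2*size≤1+t : size + size ≤ suc t
  2*size≤1+t = injective⇒≤ {f = spread ∘ splitAt size} λ {x} {y} eq →
    trans (sym (Fin.join-splitAt size size x))
      (trans (cong (join size size) (spread-injective (splitAt size x) (splitAt size y) eq)) (Fin.join-splitAt size size y))

  -- The surplus one in `2*size≤1+t` is absorbed by parity: `size + size` cannot exceed `m + m` by
  -- exactly one.
  size≤ : ∀ {m} → t ≤ m + m → size ≤ m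
  size≤ {m} t≤2m = ℕ.≮⇒≥ λ m<size → ℕ.<-irrefl refl (begin-strict
    suc (m + m)     <⟨ s≤s (ℕ.≤-reflexive (sym (ℕ.+-suc m m))) ⟩
    suc m + suc m   ≤⟨ ℕ.+-mono-≤ m<size m<size ⟩
    size + size     ≤⟨ 2*size≤1+t ⟩
    suc t           ≤⟨ s≤s t≤2m ⟩
    suc (m + m)     ∎)
    where open ℕ.≤-Reasoning

  representative : Fin t → Fin t
  representative v with lower? v
  ... | yes _ = v
  ... | no _  = σ v

  representative-lower : ∀ v → Lower (representative v)
  representative-lower v with lower? v
  ... | yes v≤σv = v≤σv
  ... | no v≰σv  = lower-σ v≰σv

  pairIndex : Fin t → Fin size
  pairIndex v = proj₁ (complete (representative-lower v))

  isLower : Fin t → Bool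
  isLower v with lower? v
  ... | yes _ = true
  ... | no _  = false

  pairIndex⇒representative : ∀ {u v} → pairIndex u ≡ pairIndex v → representative u ≡ representative v
  pairIndex⇒representative {u} {v} eq = trans (sym (proj₂ (complete (representative-lower u))))
    (trans (cong element eq) (proj₂ (complete (representative-lower v))))

  pairIndex-≡ : ∀ {u v} → pairIndex u ≡ pairIndex v → u ≡ v ⊎ σ u ≡ v
  pairIndex-≡ {u} {v} eq with lower? u | lower? v | pairIndex⇒representative {u} {v} eq
  ... | yes _ | yes _ | u≡v   = inj₁ u≡v
  ... | no _  | no _  | σu≡σv = inj₁ (trans (sym (involutive u)) (trans (cong σ σu≡σv) (involutive v)))
  ... | no _  | yes _ | σu≡v  = inj₂ σu≡v
  ... | yes _ | no _  | u≡σv  = inj₂ (trans (cong σ u≡σv) (involutive v))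

  isLower-injective : ∀ {u v} → pairIndex u ≡ pairIndex v → isLower u ≡ isLower v → u ≡ v
  isLower-injective {u} {v} eq side with lower? u | lower? v | pairIndex⇒representative {u} {v} eq
  ... | yes _ | yes _ | u≡v   = u≡v
  ... | no _  | no _  | σu≡σv = trans (sym (involutive u)) (trans (cong σ σu≡σv) (involutive v))
  isLower-injective eq () | yes _ | no _ | _
  isLower-injective eq () | no _ | yes _ | _

-- Maximal matchings, and copies of the graph in one colour.

module MaximalMatching {t} (M : EdgeSet (K t)) (maximal : IsMaximalMatching M) where
  open EdgeSet M
  matching = proj₁ maximal

  -- Two distinct unmatched vertices could be joined by a further matching edge, against maximality.
  unmatched-unique : ∀ {u v} → (∀ w → ¬ Mem u w) → (∀ w → ¬ Mem v w) → u ≡ v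
  unmatched-unique {u} {v} ¬u ¬v with u ≟ v
  ... | yes u≡v = u≡v
  ... | no u≢v = contradiction (proj₂ maximal M+uv matching+uv inj₁ (inj₂ (inj₁ (refl , refl)))) (¬u v)
    where
    M+uv : EdgeSet (K t)
    M+uv = record
      { Mem   = λ x y → Mem x y ⊎ (x ≡ u × y ≡ v) ⊎ (x ≡ v × y ≡ u)
      ; mem?  = λ x y → mem? x y ⊎-dec ((x ≟ u ×-dec y ≟ v) ⊎-dec (x ≟ v ×-dec y ≟ u))
      ; symm  = λ { (inj₁ m) → inj₁ (symm m)
                  ; (inj₂ (inj₁ (x≡u , y≡v))) → inj₂ (inj₂ (y≡v , x≡u))
                  ; (inj₂ (inj₂ (x≡v , y≡u))) → inj₂ (inj₁ (y≡u , x≡v)) }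
      ; edges = λ { (inj₁ m) → edges m
                  ; (inj₂ (inj₁ (refl , refl))) → u≢v
                  ; (inj₂ (inj₂ (refl , refl))) → ≢-sym u≢v }
      }

    matching+uv : IsMatching M+uv
    matching+uv (inj₁ m) (inj₁ m′) = matching m m′
    matching+uv (inj₁ m) (inj₂ (inj₁ (refl , _))) = contradiction m (¬u _)
    matching+uv (inj₁ m) (inj₂ (inj₂ (refl , _))) = contradiction m (¬v _)
    matching+uv (inj₂ (inj₁ (refl , _))) (inj₁ m) = contradiction m (¬u _)
    matching+uv (inj₂ (inj₂ (refl , _))) (inj₁ m) = contradiction m (¬v _)
    matching+uv (inj₂ (inj₁ (_ , refl))) (inj₂ (inj₁ (_ , refl))) = refl
    matching+uv (inj₂ (inj₁ (refl , _))) (inj₂ (inj₂ (u≡v , _))) = contradiction u≡v u≢v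
    matching+uv (inj₂ (inj₂ (refl , _))) (inj₂ (inj₁ (v≡u , _))) = contradiction (sym v≡u) u≢v
    matching+uv (inj₂ (inj₂ (_ , refl))) (inj₂ (inj₂ (_ , refl))) = refl

  -- The partner in `M`, with an unmatched vertex fixed. The orbits are therefore the matching edges
  -- and at most one single vertex, which are the parts of `K t -ᴱ M` as a complete multipartite
  -- graph.
  σ : Fin t → Fin t
  σ v with any? (mem? v)
  ... | yes (w , _) = w
  ... | no _        = v

  mem-σ : ∀ {v w} → Mem v w → σ v ≡ w
  mem-σ {v} m with any? (mem? v)
  ... | yes (_ , m′) = matching m′ m
  ... | no unmatched = contradiction (_ , m) unmatched

  σ-mem : ∀ v → σ v ≢ v → Mem v (σ v)
  σ-mem v σv≢v with any? (mem? v)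
  ... | yes (_ , m) = m
  ... | no _        = contradiction refl σv≢v

  involutive : ∀ v → σ (σ v) ≡ v
  involutive v with σ v ≟ v
  ... | yes σv≡v = trans (cong σ σv≡v) σv≡v
  ... | no σv≢v  = mem-σ (symm (σ-mem v σv≢v))

  fixed-unique : ∀ {u v} → σ u ≡ u → σ v ≡ v → u ≡ v
  fixed-unique σu≡u σv≡v = unmatched-unique (unmatched σu≡u) (unmatched σv≡v)
    where
    unmatched : ∀ {v} → σ v ≡ v → ∀ w → ¬ Mem v w
    unmatched σv≡v w m = edges m (trans (sym σv≡v) (mem-σ m))

  open Involution σ involutive fixed-unique

  nonadjacent : ∀ {u v} → pairIndex u ≡ pairIndex v → ¬ Graph.Adj (K t -ᴱ M) u v
  nonadjacent {u} eq (u≢v , ¬m) with pairIndex-≡ eq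
  ... | inj₁ u≡v  = u≢v u≡v
  ... | inj₂ refl = ¬m (σ-mem u (≢-sym u≢v))

  -- Each orbit of `σ` gets its own non-dominant colour, of which there are `m`, and is placed on
  -- the ends of an edge of that colour. Vertices of different orbits then have different `other`
  -- colours, so the edge between them is dominant.
  copyInDominantColor : ∀ {n m} (χ : EdgeColoring (suc m) (K n)) → DominantColor (EdgeColoring.color χ) →
    t ≤ m + m → Σ (Copy (K t -ᴱ M) (K n)) (IsMonochromatic χ)
  copyInDominantColor {n} {m} χ D t≤2m = record
      { map       = vertex
      ; injective = λ {u} {v} eq → isLower-injective (pair≡ u v eq) (side≡ u v eq)
      ; edges     = λ {u} {v} adj eq → nonadjacent (pair≡ u v eq) adj
      }
    , dominant , λ {u} {v} adj → monochromatic u v (λ eq → nonadjacent (pair≡ u v eq) adj) (λ eq → nonadjacent eq adj)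
    where
    open EdgeColoring χ using (color; exact) renaming (symm to color-sym)
    open DominantColor D

    hue : Fin m → Fin (suc m)
    hue = punchIn dominant

    endpoint : Bool → Fin m → Fin n
    endpoint true  j = proj₁ (exact (hue j))
    endpoint false j = proj₁ (proj₂ (exact (hue j)))

    other-endpoint : ∀ b j → other (endpoint b j) ≡ hue j
    other-endpoint true j with x , y , x≢y , xy≡j ← exact (hue j) with palette x≢y
    ... | inj₁ xy≡D = contradiction (trans (sym xy≡j) xy≡D) (Fin.punchInᵢ≢i dominant j)
    ... | inj₂ xy≡o = trans (sym xy≡o) xy≡j
    other-endpoint false j with x , y , x≢y , xy≡j ← exact (hue j) with palette (≢-sym x≢y)
    ... | inj₁ yx≡D = contradiction (trans (sym xy≡j) (trans (color-sym x y) yx≡D)) (Fin.punchInᵢ≢i dominant j)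
    ... | inj₂ yx≡o = trans (sym yx≡o) (trans (color-sym y x) xy≡j)

    pair : Fin t → Fin m
    pair v = inject≤ (pairIndex v) (size≤ t≤2m)

    vertex : Fin t → Fin n
    vertex v = endpoint (isLower v) (pair v)

    hue≡ : ∀ u v → other (vertex u) ≡ other (vertex v) → pairIndex u ≡ pairIndex v
    hue≡ u v eq = Fin.inject≤-injective _ _ _ _ (Fin.punchIn-injective dominant _ _
      (trans (sym (other-endpoint (isLower u) (pair u))) (trans eq (other-endpoint (isLower v) (pair v)))))

    pair≡ : ∀ u v → vertex u ≡ vertex v → pairIndex u ≡ pairIndex v
    pair≡ u v eq = hue≡ u v (cong other eq)

    endpoint-injective : ∀ b b′ j → endpoint b j ≡ endpoint b′ j → b ≡ b′
    endpoint-injective true  true  j _  = refl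
    endpoint-injective false false j _  = refl
    endpoint-injective true  false j eq = contradiction eq (proj₁ (proj₂ (proj₂ (exact (hue j)))))
    endpoint-injective false true  j eq = contradiction (sym eq) (proj₁ (proj₂ (proj₂ (exact (hue j)))))

    side≡ : ∀ u v → vertex u ≡ vertex v → isLower u ≡ isLower v
    side≡ u v eq = endpoint-injective _ _ (pair u)
      (trans eq (cong (λ i → endpoint (isLower v) (inject≤ i (size≤ t≤2m))) (sym (pair≡ u v eq))))

    monochromatic : ∀ u v → vertex u ≢ vertex v → pairIndex u ≢ pairIndex v →
      color (vertex u) (vertex v) ≡ dominant
    monochromatic u v distinct apart with palette distinct | palette (≢-sym distinct)
    ... | inj₁ uv≡D | _         = uv≡D
    ... | inj₂ _    | inj₁ vu≡D = trans (color-sym _ _) vu≡D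
    -- A non-dominant edge has the `other` colour of both its ends, which would put them in one
    -- orbit.
    ... | inj₂ uv≡o | inj₂ vu≡o = contradiction
      (hue≡ u v (trans (sym uv≡o) (trans (color-sym _ _) vu≡o))) apart

copyOffVertex : ∀ {k n} (χ : EdgeColoring k (K (suc n))) {a c} →
  (∀ {u v} → u ≢ a → v ≢ a → u ≢ v → EdgeColoring.color χ u v ≡ c) →
  (H : Graph) → order H ≤ n → Σ (Copy H (K (suc n))) (IsMonochromatic χ)
copyOffVertex χ {a} {c} monochromatic H t≤n = record
    { map       = vertex
    ; injective = injective
    ; edges     = λ adj → apart adj
    }
  , c , λ adj → monochromatic (Fin.punchInᵢ≢i a _) (Fin.punchInᵢ≢i a _) (apart adj)
  where
  vertex : Vertex H → Fin _
  vertex v = punchIn a (inject≤ v t≤n)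

  injective : Injective _≡_ _≡_ vertex
  injective eq = Fin.inject≤-injective _ _ _ _ (Fin.punchIn-injective a _ _ eq)

  apart : ∀ {u v} → Graph.Adj H u v → vertex u ≢ vertex v
  apart {u} adj eq = Graph.irrefl H (subst (Graph.Adj H u) (sym (injective eq)) adj)

-- From rainbow vertex sequences to rainbow copies of `P₅`.

lookup-pathColors : ∀ {A B : Set} {m} (color : A → A → B) (vs : Vec A (suc m)) i →
  lookup (pathColors color vs) i ≡ color (lookup vs (inject₁ i)) (lookup vs (suc i))
lookup-pathColors color (u ∷ v ∷ vs) zero    = refl
lookup-pathColors color (u ∷ v ∷ vs) (suc i) = lookup-pathColors color (v ∷ vs) i

module RainbowPath {k n} (χ : EdgeColoring k (K n)) where
  open EdgeColoring χ using (color) renaming (symm to color-sym)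

  consecutive : ∀ {m} {u v : Fin (suc m)} → suc (toℕ u) ≡ toℕ v → ∃[ i ] u ≡ inject₁ i × v ≡ suc i
  consecutive {v = suc i} eq = i , Fin.toℕ-injective (trans (ℕ.suc-injective eq) (sym (Fin.toℕ-inject₁ i))) , refl

  rainbowCopy : ∀ {vs : Vec (Fin n) 5} → Unique vs → Unique (pathColors color vs) →
    Σ (Copy P₅ (K n)) (IsRainbow χ)
  rainbowCopy {vs} vs! cs! = φ , λ {u} {v} {x} {y} → rainbow {u} {v} {x} {y}
    where
    φ : Copy P₅ (K n)
    φ = record
      { map       = lookup vs
      ; injective = lookup-injective vs! _ _
      ; edges     = λ {u} {v} adj eq → Graph.irrefl P₅ {u}
          (subst (Graph.Adj P₅ u) (sym (lookup-injective vs! u v eq)) adj)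
      }

    edgeIndex : ∀ u v → Graph.Adj P₅ u v → ∃[ i ]
      lookup (pathColors color vs) i ≡ color (lookup vs u) (lookup vs v) ×
      ((u ≡ inject₁ i × v ≡ suc i) ⊎ (v ≡ inject₁ i × u ≡ suc i))
    edgeIndex u v (inj₁ eq) with i , refl , refl ← consecutive eq =
      i , lookup-pathColors color vs i , inj₁ (refl , refl)
    edgeIndex u v (inj₂ eq) with i , refl , refl ← consecutive eq =
      i , trans (lookup-pathColors color vs i) (color-sym _ _) , inj₂ (refl , refl)

    rainbow : IsRainbow χ φ
    rainbow {u} {v} {x} {y} uv xy eq
      with i , uv≡ , uv-ends ← edgeIndex u v uv | j , xy≡ , xy-ends ← edgeIndex x y xy
      with refl ← lookup-injective cs! i j (trans uv≡ (trans eq (sym xy≡)))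
      with uv-ends | xy-ends
    ... | inj₁ (refl , refl) | inj₁ (refl , refl) = inj₁ (refl , refl)
    ... | inj₁ (refl , refl) | inj₂ (refl , refl) = inj₂ (refl , refl)
    ... | inj₂ (refl , refl) | inj₁ (refl , refl) = inj₂ (refl , refl)
    ... | inj₂ (refl , refl) | inj₂ (refl , refl) = inj₁ (refl , refl)

  RainbowPath : Vec (Fin n) 5 → Set
  RainbowPath vs = Unique vs × Unique (pathColors color vs)

  rainbowPath? : Dec (∃[ v₁ ] ∃[ v₂ ] ∃[ v₃ ] ∃[ v₄ ] ∃[ v₅ ] RainbowPath (v₁ ∷ v₂ ∷ v₃ ∷ v₄ ∷ v₅ ∷ []))
  rainbowPath? = any? λ v₁ → any? λ v₂ → any? λ v₃ → any? λ v₄ → any? λ v₅ →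
    unique? _ ×-dec unique? _

  -- The alternative is decided by exhaustive search over all sequences of five vertices.
  copy⊎noRainbow : Σ (Copy P₅ (K n)) (IsRainbow χ) ⊎
    (∀ {vs : Vec (Fin n) 5} → Unique vs → ¬ Unique (pathColors color vs))
  copy⊎noRainbow with rainbowPath?
  ... | yes (v₁ , v₂ , v₃ , v₄ , v₅ , vs! , cs!) = inj₁ (rainbowCopy vs! cs!)
  ... | no ¬path = inj₂ λ { {v₁ ∷ v₂ ∷ v₃ ∷ v₄ ∷ v₅ ∷ []} vs! cs! → ¬path (v₁ , v₂ , v₃ , v₄ , v₅ , vs! , cs!) }

-- The lower bound from a star colouring.

injective⇒surjective : ∀ {n} {f : Fin n → Fin n} → Injective _≡_ _≡_ f → ∀ y → ∃[ x ] f x ≡ y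
injective⇒surjective {suc n} {f} f-injective y with any? (λ x → f x ≟ y)
... | yes preimage = preimage
... | no ¬preimage = contradiction (injective⇒≤ (f-injective ∘ Fin.punchOut-injective (avoids _) (avoids _))) ℕ.1+n≰n
  where
  avoids : ∀ x → y ≢ f x
  avoids x y≡fx = ¬preimage (x , sym y≡fx)

module StarColoring {k t} (k≤t : suc k ≤ t) where

  -- The first `suc k` spokes already carry every colour; later ones repeat the colour `zero` used
  -- away from the centre.
  spoke : Fin t → Fin (suc k)
  spoke i with toℕ i ℕ.<? suc k
  ... | yes i<k = fromℕ< i<k
  ... | no _    = zero

  spoke-inject≤ : ∀ c → spoke (inject≤ c k≤t) ≡ c
  spoke-inject≤ c with toℕ (inject≤ c k≤t) ℕ.<? suc k
  ... | yes c<k = Fin.toℕ-injective (trans (Fin.toℕ-fromℕ< c<k) (Fin.toℕ-inject≤ c k≤t))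
  ... | no c≮k = contradiction (subst (_< suc k) (sym (Fin.toℕ-inject≤ c k≤t)) (Fin.toℕ<n c)) c≮k

  starColor : Fin (suc t) → Fin (suc t) → Fin (suc k)
  starColor zero    zero    = zero
  starColor zero    (suc i) = spoke i
  starColor (suc i) zero    = spoke i
  starColor (suc _) (suc _) = zero

  star : EdgeColoring (suc k) (K (suc t))
  star = record
    { color = starColor
    ; symm  = λ { zero zero → refl ; zero (suc _) → refl ; (suc _) zero → refl ; (suc _) (suc _) → refl }
    ; exact = λ c → zero , suc (inject≤ c k≤t) , (λ ()) , spoke-inject≤ c
    }

  offCentre : ∀ {u v} → u ≢ zero → v ≢ zero → starColor u v ≡ zero
  offCentre {zero}          u≢0 _   = contradiction refl u≢0
  offCentre {suc _} {zero}  _   v≢0 = contradiction refl v≢0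
  offCentre {suc _} {suc _} _   _   = refl

  module _ (φ : Copy P₅ (K (suc t))) (rainbow : IsRainbow star φ) where
    open Copy φ

    private
      away : ∀ {i j} → map i ≡ zero → j ≢ i → map j ≢ zero
      away φᵢ≡0 j≢i φⱼ≡0 = j≢i (injective (trans φⱼ≡0 (sym φᵢ≡0)))

      sameEdge : ∀ u v x y → Graph.Adj P₅ u v → Graph.Adj P₅ x y →
        map u ≢ zero → map v ≢ zero → map x ≢ zero → map y ≢ zero → (u ≡ x × v ≡ y) ⊎ (u ≡ y × v ≡ x)
      sameEdge u v x y uv xy u≢0 v≢0 x≢0 y≢0 =
        rainbow uv xy (trans (offCentre u≢0 v≢0) (sym (offCentre x≢0 y≢0)))

      lastEdges : map 2F ≢ zero → map 3F ≢ zero → map 4F ≢ zero → ⊥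
      lastEdges φ₂ φ₃ φ₄ with sameEdge 2F 3F 3F 4F (inj₁ refl) (inj₁ refl) φ₂ φ₃ φ₃ φ₄
      ... | inj₁ (() , _)
      ... | inj₂ (() , _)

      firstEdges : map 0F ≢ zero → map 1F ≢ zero → map 2F ≢ zero → ⊥
      firstEdges φ₀ φ₁ φ₂ with sameEdge 0F 1F 1F 2F (inj₁ refl) (inj₁ refl) φ₀ φ₁ φ₁ φ₂
      ... | inj₁ (() , _)
      ... | inj₂ (() , _)

    -- Two edges of the path always avoid the centre, and both have colour `zero`. If the centre is
    -- the middle vertex or lies off the path, these are the two end edges.
    noRainbow : ⊥
    noRainbow with map 0F ≟ zero | map 1F ≟ zero | map 3F ≟ zero | map 4F ≟ zero
    ... | yes φ₀ | _      | _      | _      = lastEdges (away φ₀ λ ()) (away φ₀ λ ()) (away φ₀ λ ())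
    ... | no _   | yes φ₁ | _      | _      = lastEdges (away φ₁ λ ()) (away φ₁ λ ()) (away φ₁ λ ())
    ... | no _   | no _   | yes φ₃ | _      = firstEdges (away φ₃ λ ()) (away φ₃ λ ()) (away φ₃ λ ())
    ... | no _   | no _   | no _   | yes φ₄ = firstEdges (away φ₄ λ ()) (away φ₄ λ ()) (away φ₄ λ ())
    ... | no φ₀  | no φ₁  | no φ₃  | no φ₄
      with sameEdge 0F 1F 3F 4F (inj₁ refl) (inj₁ refl) φ₀ φ₁ φ₃ φ₄
    ...   | inj₁ (() , _)
    ...   | inj₂ (() , _)

  module _ (2≤k : 2 ≤ k) (M : EdgeSet (K (suc t))) (matching : IsMatching M)
    (φ : Copy (K (suc t) -ᴱ M) (K (suc t))) (monochromatic : IsMonochromatic star φ) where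
    open Copy φ
    open EdgeSet M using (Mem; mem?)

    private
      hue : Fin 3 → Fin (suc k)
      hue i = inject≤ i (s≤s 2≤k)

      leaf : Fin 3 → Fin (suc t)
      leaf i = suc (inject≤ (hue i) k≤t)

      leaf-injective : ∀ {i j} → leaf i ≡ leaf j → i ≡ j
      leaf-injective eq = Fin.inject≤-injective _ _ _ _ (Fin.inject≤-injective _ _ _ _ (Fin.suc-injective eq))

      centre : Fin (suc t)
      centre = proj₁ (injective⇒surjective injective zero)

      centre≡ : map centre ≡ zero
      centre≡ = proj₂ (injective⇒surjective injective zero)

      end : Fin 3 → Fin (suc t)
      end i = proj₁ (injective⇒surjective injective (leaf i))

      end≡ : ∀ i → map (end i) ≡ leaf i
      end≡ i = proj₂ (injective⇒surjective injective (leaf i))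

      centre≢end : ∀ i → centre ≢ end i
      centre≢end i eq with () ← trans (sym centre≡) (trans (cong map eq) (end≡ i))

      hue≡ : ∀ i → ¬ Mem centre (end i) → hue i ≡ proj₁ monochromatic
      hue≡ i ¬m = trans (sym (spoke-inject≤ (hue i)))
        (trans (sym (cong₂ starColor centre≡ (end≡ i))) (proj₂ monochromatic (centre≢end i , ¬m)))

      bothAdjacent : ∀ {i j} → i ≢ j → ¬ Mem centre (end i) → ¬ Mem centre (end j) → ⊥
      bothAdjacent {i} {j} i≢j ¬mᵢ ¬mⱼ =
        i≢j (Fin.inject≤-injective _ _ i j (trans (hue≡ i ¬mᵢ) (sym (hue≡ j ¬mⱼ))))

      bothMatched : ∀ {i j} → i ≢ j → Mem centre (end i) → Mem centre (end j) → ⊥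
      bothMatched {i} {j} i≢j mᵢ mⱼ =
        i≢j (leaf-injective (trans (sym (end≡ i)) (trans (cong map (matching mᵢ mⱼ)) (end≡ j))))

    -- The copy is spanning, so it covers the centre and three leaves whose spokes have distinct
    -- colours. The vertex over the centre has at most one partner in `M`, hence at least two of
    -- these spokes belong to the copy.
    noMonochromatic : ⊥
    noMonochromatic with mem? centre (end 0F) | mem? centre (end 1F) | mem? centre (end 2F)
    ... | yes m₀ | yes m₁ | _      = bothMatched (λ ()) m₀ m₁
    ... | yes m₀ | no _   | yes m₂ = bothMatched (λ ()) m₀ m₂
    ... | yes _  | no ¬m₁ | no ¬m₂ = bothAdjacent (λ ()) ¬m₁ ¬m₂
    ... | no ¬m₀ | no ¬m₁ | _      = bothAdjacent (λ ()) ¬m₀ ¬m₁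
    ... | no ¬m₀ | yes _  | no ¬m₂ = bothAdjacent (λ ()) ¬m₀ ¬m₂
    ... | no _   | yes m₁ | yes m₂ = bothMatched (λ ()) m₁ m₂

-- Arithmetic of the two bounds.

2*[1+n]C2≡n*[1+n] : ∀ n → 2 * (suc n C 2) ≡ n * suc n
2*[1+n]C2≡n*[1+n] ℕ.zero = refl
2*[1+n]C2≡n*[1+n] (suc n) = begin
  2 * (suc (suc n) C 2)             ≡⟨ cong (2 *_) (nCk+nC[k+1]≡[n+1]C[k+1] (suc n) 1) ⟨
  2 * (suc n C 1 + suc n C 2)       ≡⟨ ℕ.*-distribˡ-+ 2 (suc n C 1) (suc n C 2) ⟩
  2 * (suc n C 1) + 2 * (suc n C 2) ≡⟨ cong₂ (λ x y → 2 * x + y) (nC1≡n (suc n)) (2*[1+n]C2≡n*[1+n] n) ⟩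
  2 * suc n + n * suc n             ≡⟨ ℕ.*-distribʳ-+ (suc n) 2 n ⟨
  suc (suc n) * suc n               ≡⟨ ℕ.*-comm (suc (suc n)) (suc n) ⟩
  suc n * suc (suc n)               ∎
  where open ≡-Reasoning

-- This identity makes the square-root condition on a positive `N` for `1 + 8 * k` equivalent to
-- `k ≤ N C 2`.
[2n-1]²≡1+8*nC2 : ∀ n → (2 * suc n ∸ 1) ^ 2 ≡ 1 + 8 * (suc n C 2)
[2n-1]²≡1+8*nC2 n = begin
  (n + suc (n + 0)) ^ 2         ≡⟨ square n ⟩
  1 + 4 * (n * suc n)           ≡⟨ cong (λ x → 1 + 4 * x) (2*[1+n]C2≡n*[1+n] n) ⟨
  1 + 4 * (2 * (suc n C 2))     ≡⟨ cong (1 +_) (ℕ.*-assoc 4 2 (suc n C 2)) ⟨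
  1 + 8 * (suc n C 2)           ∎
  where
  open ≡-Reasoning
  square : ∀ n → (n + suc (n + 0)) * ((n + suc (n + 0)) * 1) ≡ 1 + 4 * (n * suc n)
  square = solve-∀

≤C2⇒[1+√]/2≤ : ∀ {k n} → k ≤ suc n C 2 → [1+√ 1 + 8 * k ]/2≤ suc n
≤C2⇒[1+√]/2≤ {k} {n} k≤C = s≤s z≤n ,
  ℕ.≤-trans (s≤s (ℕ.*-monoʳ-≤ 8 k≤C)) (ℕ.≤-reflexive (sym ([2n-1]²≡1+8*nC2 n)))

[1+√]/2≤⇒≤C2 : ∀ {k n} → [1+√ 1 + 8 * k ]/2≤ n → k ≤ n C 2
[1+√]/2≤⇒≤C2 {k} {suc n} (_ , 1+8k≤) = ℕ.*-cancelˡ-≤ 8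
  (ℕ.s≤s⁻¹ (ℕ.≤-trans 1+8k≤ (ℕ.≤-reflexive ([2n-1]²≡1+8*nC2 n))))

[1+√]/2≤-mono : ∀ {x m n} → m ≤ n → [1+√ x ]/2≤ m → [1+√ x ]/2≤ n
[1+√]/2≤-mono m≤n (1≤2m , x≤) = ℕ.≤-trans 1≤2m 2m≤2n ,
  ℕ.≤-trans x≤ (ℕ.^-monoˡ-≤ 2 (ℕ.∸-monoˡ-≤ 1 2m≤2n))
  where 2m≤2n = ℕ.*-monoʳ-≤ 2 m≤n

-- The hypothesis amounts to `⌈ t /2⌉ ≤ k ∸ 1`, and `t` is at most twice `⌈ t /2⌉`.
t≤2[k-1] : ∀ {t k} → ⌈ t + 2 /2⌉ ≤ k → t ≤ (k ∸ 1) + (k ∸ 1)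
t≤2[k-1] {t} {k} ⌈t+2/2⌉≤k rewrite ℕ.+-comm t 2 = begin
  t                   ≡⟨ ℕ.⌊n/2⌋+⌈n/2⌉≡n t ⟨
  ⌊ t /2⌋ + ⌈ t /2⌉   ≤⟨ ℕ.+-monoˡ-≤ ⌈ t /2⌉ (ℕ.⌊n/2⌋≤⌈n/2⌉ t) ⟩
  ⌈ t /2⌉ + ⌈ t /2⌉   ≤⟨ ℕ.+-mono-≤ ⌈t/2⌉≤k-1 ⌈t/2⌉≤k-1 ⟩
  (k ∸ 1) + (k ∸ 1)   ∎
  where
  open ℕ.≤-Reasoning
  ⌈t/2⌉≤k-1 = ℕ.∸-monoˡ-≤ 1 ⌈t+2/2⌉≤k

-- Determination of the Gallai-Ramsey number.

rainbow⊎monochromatic : ∀ {k t n} → 4 ≤ k → suc k ≤ t → t ≤ k + k → t ≤ n →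
  (M : EdgeSet (K t)) → IsMaximalMatching M → (χ : EdgeColoring (suc k) (K (suc n))) →
  Σ (Copy P₅ (K (suc n))) (IsRainbow χ) ⊎ Σ (Copy (K t -ᴱ M) (K (suc n))) (IsMonochromatic χ)
rainbow⊎monochromatic {k} {t} {n} 4≤k k<t t≤2k t≤n M maximal χ with RainbowPath.copy⊎noRainbow χ
... | inj₁ copy = inj₁ copy
... | inj₂ noRainbow
  with NoRainbowPath.monochromatic⊎2colored color color-sym noRainbow 4<1+n (s≤s 4≤k) exact
  where
  open EdgeColoring χ using (color; exact) renaming (symm to color-sym)
  4<1+n : 4 < suc n
  4<1+n = s≤s (ℕ.≤-trans 4≤k (ℕ.≤-trans (ℕ.n≤1+n k) (ℕ.≤-trans k<t t≤n)))
... | inj₁ (a , c , monochromatic) = inj₂ (copyOffVertex χ monochromatic (K t -ᴱ M) t≤n)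
... | inj₂ 2colored = inj₂ (MaximalMatching.copyInDominantColor M maximal χ
  (dominantColor color color-sym (s≤s 4≤k) exact 2colored) t≤2k)
  where open EdgeColoring χ using (color; exact) renaming (symm to color-sym)

⌈[1+√]/2⌉-isLeast : ∀ x → IsLeast ([1+√ x ]/2≤_) ⌈[1+√ x ]/2⌉
⌈[1+√]/2⌉-isLeast x = proj₂ (least ([1+√ x ]/2≤?_) (suc x) ([1+√]/2-bounded x))

-- The ceiling enters only through being least, so a variable `c` with that property stands for it.
gr≡⊔ : ∀ {c} k t → IsLeast ([1+√ 1 + 8 * k ]/2≤_) c → t ≤ (k ∸ 1) + (k ∸ 1) → k ≤ t ∸ 1 → 5 ≤ k →
  (M : EdgeSet (K t)) → IsMaximalMatching M → gr k [ P₅ ∶ K t -ᴱ M ]≡ (c ⊔ (t + 1))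
gr≡⊔ {c} (suc k) (suc t) (c-ok , c-least) t≤2k k≤t (s≤s 4≤k) M maximal = (enoughEdges , upper) , lower
  where
  H = K (suc t) -ᴱ M

  enoughEdges : suc k ≤ (c ⊔ (suc t + 1)) C 2
  enoughEdges = [1+√]/2≤⇒≤C2 {n = c ⊔ (suc t + 1)} ([1+√]/2≤-mono {m = c} (ℕ.m≤m⊔n c (suc t + 1)) c-ok)

  upper : ∀ n → c ⊔ (suc t + 1) ≤ n → (χ : EdgeColoring (suc k) (K n)) →
    Σ (Copy P₅ (K n)) (IsRainbow χ) ⊎ Σ (Copy H (K n)) (IsMonochromatic χ)
  upper n N≤n χ with ℕ.≤-trans (ℕ.≤-reflexive (ℕ.+-comm 1 (suc t))) (ℕ.≤-trans (ℕ.m≤n⊔m c (suc t + 1)) N≤n)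
  ... | s≤s t<n = rainbow⊎monochromatic 4≤k (s≤s (ℕ.≤-trans (ℕ.n≤1+n k) k≤t)) t≤2k t<n M maximal χ

  lower : ∀ N → GallaiRamseyBound (suc k) P₅ H N → c ⊔ (suc t + 1) ≤ N
  lower ℕ.zero (() , _)
  lower (suc N) (k≤NC2 , ramsey) = ℕ.⊔-lub (c-least (suc N) (≤C2⇒[1+√]/2≤ k≤NC2))
    (ℕ.≤-trans (ℕ.≤-reflexive (ℕ.+-comm (suc t) 1)) (ℕ.≰⇒> small))
    where
    open StarColoring k≤t
    -- A Ramsey bound covers all larger orders too, so it can be tested on `star`, whose order is
    -- `suc t`.
    small : ¬ suc N ≤ suc t
    small N≤t with ramsey (suc t) N≤t star
    ... | inj₁ (φ , rainbow) = noRainbow φ rainbow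
    ... | inj₂ (φ , monochromatic) = noMonochromatic (ℕ.≤-trans (s≤s (s≤s z≤n)) 4≤k) M (proj₁ maximal) φ monochromatic

theorem2p6 : (k t : ℕ) → ⌈ t + 2 /2⌉ ≤ k → k ≤ t ∸ 1 → 5 ≤ k →
    (M : EdgeSet (K t)) → IsMaximalMatching M →
    gr k [ P₅ ∶ K t -ᴱ M ]≡ (⌈[1+√ 1 + 8 * k ]/2⌉ ⊔ (t + 1))
theorem2p6 k t ⌈t+2/2⌉≤k = gr≡⊔ k t (⌈[1+√]/2⌉-isLeast (1 + 8 * k)) (t≤2[k-1] ⌈t+2/2⌉≤k)
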